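{- For every $n\ge 1$: (i) $b_2(\mathcal{A}_n)=2S(n+1,3)+3S(n+1,4)=\frac12\left(4^n-3^n-2^n+1\right)$; (ii) $b_3(\mathcal{A}_n)=9S(n+1,4)+80S(n+1,5)+345S(n+1,6)+840S(n+1,7)+840S(n+1,8)=\frac{1}{4!}\left(4\cdot 8^n-15\cdot 6^n+15\cdot5^n-14\cdot4^n+18\cdot3^n-7\cdot2^n-1\right)$.
   Context: For $n\ge1$ the resonance arrangement $\mathcal{A}_n$ is the arrangement in $\mathbb{R}^n$ of the hyperplanes $H_I=\{x:\sum_{i\in I}x_i=0\}$ for all nonempty $I\subseteq[n]$. For an arrangement $\mathcal{A}$ in $\mathbb{F}^n$, its characteristic polynomial is $\chi(\mathcal{A};t)=\sum_{S\subseteq\mathcal{A}}(-1)^{|S|}t^{r(\mathcal{A})-r(S)}$, where $r(S)=\operatorname{codim}\bigcap_{H\in S}H$. The $i$-th Betti number $b_i(\mathcal{A})$ is the absolute value of the coefficient of $t^{n-i}$ in $\chi(\mathcal{A};t)$. $S(n,k)$ denotes the Stirling number of the second kind. -}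

module Defs where

open import Data.Bool using (Bool; true; false; if_then_else_; _∨_)
open import Data.Nat as ℕ using (ℕ; zero; suc; _≤_)
open import Data.Integer as ℤ using (ℤ; +_; -1ℤ; 1ℤ; 0ℤ; ∣_∣)
open import Data.Integer.Properties using () renaming (_≟_ to _≟ℤ_)
open import Data.Rational as ℚ using (ℚ; 0ℚ; 1ℚ)
open import Data.Fin using (Fin)
open import Data.Vec as Vec using (Vec; []; _∷_; lookup)
open import Data.List as List using (List; []; _∷_; [_]; length; map; filter; _++_)
open import Data.List.Relation.Unary.All using (All)
open import Data.List.Relation.Binary.Sublist.Propositional using (_⊆_)
open import Data.Product using (Σ; ∃; _×_)
open import Relation.Binary.PropositionalEquality using (_≡_)
open import Relation.Nullary.Decidable using (does)

stirling2 : ℕ → ℕ → ℕ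
stirling2 zero    zero    = 1
stirling2 zero    (suc k) = 0
stirling2 (suc n) zero    = 0
stirling2 (suc n) (suc k) = suc k ℕ.* stirling2 n (suc k) ℕ.+ stirling2 n k

Subset : ℕ → Set
Subset n = Vec Bool n

allSubsets : (n : ℕ) → List (Subset n)
allSubsets zero    = [ [] ]
allSubsets (suc n) = map (false ∷_) (allSubsets n) ++ map (true ∷_) (allSubsets n)

isNonempty : ∀ {n} → Subset n → Bool
isNonempty []       = false
isNonempty (b ∷ bs) = b ∨ isNonempty bs

-- A hyperplane H_I is represented by its index set I (a nonempty subset of [n]);
-- H_I = { x ∈ ℝⁿ : Σ_{i∈I} x_i = 0 } has normal vector the indicator vector of I.
normal : ∀ {n} → Subset n → Fin n → ℚ
normal I i = if lookup I i then 1ℚ else 0ℚ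

resonance : (n : ℕ) → List (Subset n)
resonance n = filter (λ I → isNonempty I Data.Bool.≟ true) (allSubsets n)
  where import Data.Bool

subcollections : ∀ {A : Set} → List A → List (List A)
subcollections []       = [ [] ]
subcollections (x ∷ xs) = map (x ∷_) (subcollections xs) ++ subcollections xs

linComb : ∀ {n} → List ℚ → List (Fin n → ℚ) → Fin n → ℚ
linComb (c ∷ cs) (v ∷ vs) i = c ℚ.* v i ℚ.+ linComb cs vs i
linComb _        _        i = 0ℚ

LinIndep : ∀ {n} → List (Fin n → ℚ) → Set
LinIndep {n} vs = (c : List ℚ) → length c ≡ length vs →
                  (∀ (i : Fin n) → linComb c vs i ≡ 0ℚ) → All (_≡ 0ℚ) c

-- r is the rank function on collections of hyperplanes of the form H_I:
-- r(S) = codim ⋂_{H ∈ S} H = dimension of the span of the normals of S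
--      = maximal size of a linearly independent sub-collection of S.
IsRankFunction : ∀ {n} → (List (Subset n) → ℕ) → Set
IsRankFunction {n} r = ∀ (S : List (Subset n)) →
    (Σ (List (Subset n)) λ T → T ⊆ S × length T ≡ r S × LinIndep (map normal T))
  × (∀ (T : List (Subset n)) → T ⊆ S → LinIndep (map normal T) → length T ≤ r S)

signPow : ℕ → ℤ
signPow zero    = 1ℤ
signPow (suc m) = -1ℤ ℤ.* signPow m

-- coefficient of t^k (k ∈ ℤ) in χ(𝒜;t) = Σ_{S ⊆ 𝒜} (-1)^{|S|} t^{r(𝒜) - r(S)}
charPolyCoeff : ∀ {n} → (List (Subset n) → ℕ) → List (Subset n) → ℤ → ℤ
charPolyCoeff r 𝒜 k = List.foldr ℤ._+_ 0ℤ (map term (subcollections 𝒜))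
  where
  term : _ → ℤ
  term S = if does (((+ r 𝒜) ℤ.- (+ r S)) ≟ℤ k) then signPow (length S) else 0ℤ

betti : ∀ {n} → (List (Subset n) → ℕ) → List (Subset n) → ℕ → ℕ
betti {n} r 𝒜 i = ∣ charPolyCoeff r 𝒜 ((+ n) ℤ.- (+ i)) ∣

List' : ℕ → Set
List' n = List (Subset n)

{-# OPTIONS --safe #-}

-- By Whitney's theorem the coefficient of t^{n−i} is (−1)^i times the number of i-element subcollections
-- without a broken circuit, for any linear order of the hyperplanes. Order the index sets by decreasing binary value.
-- A pair is then free of broken circuits iff its members meet. A triple a ≻ b ≻ c is free of them iff its members meet pairwise
-- and neither a + b − c (forcing a ∩ b ⊆ c ⊆ a ∪ b) nor (a + b + c)/2 is the indicator vector of a set: the coefficients of a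
-- relation y = αa + βb + γc with y ≻ a are forced to be small integers or all ½, and the order excludes the remaining cases,
-- for instance y = a − b + c, because y − a = c − b would make c precede b.
-- All these conditions can be read off the columns (aᵢ, bᵢ, cᵢ) by a finite automaton, whose accepted words are counted
-- by diagonalising its transition operator; the Stirling numbers are diagonalised in the same way.

module Submission where

open import Defs
open import Data.Bool using (Bool; true; false; if_then_else_; _∧_; _∨_; not; _xor_)
import Data.Bool as 𝔹
open import Data.Bool.Properties using (∧-assoc; ∧-zeroʳ)
open import Data.Nat as ℕ using (ℕ; zero; suc; _+_; _*_; _^_; _≤_; z≤n; s≤s)
import Data.Nat.Properties as ℕ
open import Data.Integer as ℤ using (ℤ; +_; -[1+_]; -1ℤ; 1ℤ; 0ℤ; ∣_∣)
import Data.Integer.Properties as ℤ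
import Data.Integer.Solver as ℤSolver
open import Data.Integer.Tactic.RingSolver using (solve-∀)
open import Data.Rational as ℚ using (ℚ; 0ℚ; 1ℚ; ½)
import Data.Rational.Properties as ℚ
import Data.Rational.Solver as ℚSolver
open import Data.Fin as Fin using (Fin; zero; suc; toℕ; inject₁)
import Data.Fin.Properties as Fin
open import Data.Vec as Vec using (Vec; []; _∷_; lookup; tabulate; replicate)
open import Data.Vec.Properties using (lookup∘tabulate; lookup-replicate)
open import Data.List as List using (List; []; _∷_; length; map; filter; foldr; concatMap; _++_)
open import Data.List.Properties using (length-map; ++-assoc; ++-identityʳ)
open import Data.List.Membership.Propositional using (_∈_)
open import Data.List.Membership.Propositional.Properties using (∈-∃++; ∈-map⁺; ∈-map⁻; ∈-++⁺ˡ; ∈-++⁺ʳ; ∈-++⁻; ∈-filter⁺; ∈-filter⁻)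
open import Data.List.Relation.Unary.Any using (here; there)
open import Data.List.Relation.Unary.All as All using (All; []; _∷_)
import Data.List.Relation.Unary.All.Properties as All
open import Data.List.Relation.Unary.AllPairs as AllPairs using (AllPairs; []; _∷_)
import Data.List.Relation.Unary.AllPairs.Properties as AllPairs
open import Data.List.Relation.Binary.Permutation.Propositional as ↭ using (_↭_; ↭-refl; ↭-sym; ↭-trans; ↭-reflexive)
import Data.List.Relation.Binary.Permutation.Propositional.Properties as ↭
open import Data.List.Relation.Binary.Sublist.Propositional as Sublist using (_⊆_; []; _∷_; _∷ʳ_; ⊆-refl)
open import Data.List.Relation.Binary.Sublist.Propositional.Properties using (length-mono-≤)
open import Data.Product using (∃; _×_; _,_; proj₁; proj₂)
open import Data.Sum using (_⊎_; inj₁; inj₂; [_,_]′)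
open import Data.Unit using (⊤; tt)
open import Data.Empty using (⊥)
open import Function using (_∘_)
open import Relation.Nullary using (¬_; Dec; yes; no; does; contradiction)
open import Relation.Nullary.Decidable using (¬?; map′; _×-dec_; _→-dec_; decidable-stable; True; toWitness)
open import Relation.Binary.PropositionalEquality using (_≡_; _≢_; refl; sym; trans; cong; cong₂; subst; subst₂; module ≡-Reasoning)

-- Matroid closure and rank

-- The rank function is any one that satisfies `IsRankFunction`, and no elimination is carried out.
-- The matroid axioms for the rational span show instead that `r` depends only on the closure, and
-- that `x` lies in the closure of `S` iff `r (x ∷ S)` equals `r S`. This makes membership in a
-- closure decidable; before that point, case distinctions on it run under double negation and serve
-- decidable or stable goals. Whitney's theorem is proved for every weight on subcollections that
-- depends only on the closure, not just for weights read off the rank. Putting a new top element x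
-- in front of the list turns the weight φ into S ↦ φ(S) - φ(x ∷ S). This is in general no function
-- of the rank, but it again depends only on the closure, so the induction on the list closes. The
-- Betti numbers and the Stirling sums are compared through 1ⁿ, ..., 8ⁿ: over the common denominator
-- 7! both become integer combinations of these powers, and only eight coefficients have to be
-- matched.

module Matroid {A : Set} (Cl : List A → A → Set)
  (cl-stable : ∀ {S x} → ¬ ¬ Cl S x → Cl S x)
  (cl-∈ : ∀ {S x} → x ∈ S → Cl S x)
  (cl-trans : ∀ {S T x} → Cl S x → (∀ {s} → s ∈ S → Cl T s) → Cl T x)
  (cl-exchange : ∀ {S x y} → Cl (x ∷ S) y → ¬ Cl S y → Cl (y ∷ S) x)
  where

  cl-mono : ∀ {S T x} → (∀ {s} → s ∈ S → s ∈ T) → Cl S x → Cl T x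
  cl-mono S⊆T c = cl-trans c (cl-∈ ∘ S⊆T)

  Ind : List A → Set
  Ind []      = ⊤
  Ind (x ∷ T) = ¬ Cl T x × Ind T

  -- `Ind` tests each element against its tail only; that the order is nevertheless immaterial rests
  -- on the exchange axiom, which enters at a transposition.
  ind-↭ : ∀ {S T} → S ↭ T → Ind S → Ind T
  ind-↭ ↭.refl          i                 = i
  ind-↭ (↭.prep x p)    (x∉ , i)          = x∉ ∘ cl-mono (↭.∈-resp-↭ (↭-sym p)) , ind-↭ p i
  ind-↭ (↭.swap x y p) (x∉ , y∉ , i) =
    (λ c → x∉ (cl-exchange (cl-mono (↭.∈-resp-↭ (↭.prep x (↭-sym p))) c) y∉)) ,
    (λ c → x∉ (cl-mono (there ∘ ↭.∈-resp-↭ (↭-sym p)) c)) ,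
    ind-↭ p i
  ind-↭ (↭.trans p q)   i                 = ind-↭ q (ind-↭ p i)

  -- Induction on `ys`, with `zs` holding the elements already exchanged in. If `y` is dropped,
  -- either all of `xs` stays in the closure, or some `x` escapes; then `x` replaces `y` and moves
  -- from `xs` to `zs`. Which case occurs is not decided, but `≤` on ℕ is stable.
  steinitz : ∀ ys {xs} zs → Ind (xs ++ zs) → (∀ {x} → x ∈ xs → Cl (ys ++ zs) x) → length xs ≤ length ys
  steinitz [] {[]}     zs i h = z≤n
  steinitz [] {x ∷ xs} zs i h = contradiction (cl-mono (∈-++⁺ʳ xs) (h (here refl))) (proj₁ i)
  steinitz (y ∷ ys) {xs} zs i h = decidable-stable (length xs ℕ.≤? suc (length ys)) λ ≰ →
    ≰ (ℕ.m≤n⇒m≤1+n (steinitz ys zs i λ x∈ → cl-stable λ x∉ → ≰ (exchanged x∈ x∉)))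
    where
    exchanged : ∀ {x} → x ∈ xs → ¬ Cl (ys ++ zs) x → length xs ≤ suc (length ys)
    exchanged {x} x∈ x∉ with ∈-∃++ x∈
    ... | as , bs , refl = ℕ.≤-trans (ℕ.≤-reflexive (↭.↭-length (↭.shift x as bs)))
      (s≤s (steinitz ys (x ∷ zs) (ind-↭ move i) λ s∈ → cl-trans (h (old (∈-++⁻ as s∈))) new))
      where
      move : (as ++ x ∷ bs) ++ zs ↭ (as ++ bs) ++ x ∷ zs
      move = ↭.trans (↭-reflexive (++-assoc as (x ∷ bs) zs))
        (↭.trans (↭.shift x as (bs ++ zs))
        (↭.trans (↭.prep x (↭-reflexive (sym (++-assoc as bs zs)))) (↭-sym (↭.shift x (as ++ bs) zs))))
      old : ∀ {s} → s ∈ as ⊎ s ∈ bs → s ∈ as ++ x ∷ bs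
      old = [ ∈-++⁺ˡ , ∈-++⁺ʳ as ∘ there ]′
      new : ∀ {s} → s ∈ y ∷ ys ++ zs → Cl (ys ++ x ∷ zs) s
      new (here refl) = cl-mono (↭.∈-resp-↭ (↭-sym (↭.shift x ys zs))) (cl-exchange (h x∈) x∉)
      new (there s∈)  = cl-∈ (↭.∈-resp-↭ (↭-sym (↭.shift x ys zs)) (there s∈))

  Basis : List A → List A → Set
  Basis S T = T ⊆ S × Ind T × (∀ {s} → s ∈ S → Cl T s)

  -- Each element is either spanned already or joins the basis. This alternative is not yet
  -- decidable, hence the double negation.
  basis : ∀ S → ¬ ¬ ∃ (Basis S)
  basis []      k = k ([] , [] , tt , λ ())
  basis (x ∷ S) k = basis S λ { (T , T⊆S , i , h) →
    let x∈clT = λ c → k (T , x ∷ʳ T⊆S , i , λ { (here refl) → c ; (there s∈) → h s∈ }) in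
    k (x ∷ T , refl ∷ T⊆S , (x∈clT , i) ,
       λ { (here refl) → cl-∈ (here refl) ; (there s∈) → cl-mono there (h s∈) }) }

  _≼_ : List A → List A → Set
  S ≼ T = ∀ {s} → s ∈ S → Cl T s

  ≼-∷ : ∀ x {S T} → S ≼ T → (x ∷ S) ≼ (x ∷ T)
  ≼-∷ x h (here refl) = cl-∈ (here refl)
  ≼-∷ x h (there s∈)  = cl-mono there (h s∈)

  ≼-⊆ : ∀ {S T} → (∀ {s} → s ∈ S → s ∈ T) → S ≼ T
  ≼-⊆ h = cl-∈ ∘ h

  module Rank (r : List A → ℕ)
    (r-attained : ∀ S → ∃ λ T → T ⊆ S × length T ≡ r S × Ind T)
    (r-maximal : ∀ S T → T ⊆ S → Ind T → length T ≤ r S)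
    where

    rank-mono : ∀ {S S′} → S ≼ S′ → r S ≤ r S′
    rank-mono {S} {S′} h with r-attained S
    ... | T , T⊆S , |T|≡rS , i = decidable-stable (r S ℕ.≤? r S′) λ ≰ →
      basis S′ λ { (T′ , T′⊆S′ , i′ , h′) → ≰ (begin
        r S       ≡⟨ |T|≡rS ⟨
        length T  ≤⟨ steinitz T′ [] (subst Ind (sym (++-identityʳ T)) i)
                       (λ x∈ → subst (λ Z → Cl Z _) (sym (++-identityʳ T′)) (cl-trans (h (Sublist.lookup T⊆S x∈)) h′)) ⟩
        length T′ ≤⟨ r-maximal S′ T′ T′⊆S′ i′ ⟩
        r S′      ∎) }
      where open ℕ.≤-Reasoning

    rank-cong : ∀ {S S′} → S ≼ S′ → S′ ≼ S → r S ≡ r S′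
    rank-cong h h′ = ℕ.≤-antisym (rank-mono h) (rank-mono h′)

    rank-ind : ∀ {S} → Ind S → r S ≡ length S
    rank-ind {S} i with r-attained S
    ... | T , T⊆S , |T|≡rS , _ = ℕ.≤-antisym
      (subst (_≤ length S) |T|≡rS (length-mono-≤ T⊆S)) (r-maximal S S ⊆-refl i)

    -- If the two ranks agree, an `x` outside the closure would extend an independent collection
    -- attaining `r S` beyond the maximum for `x ∷ S`.
    cl? : ∀ S x → Dec (Cl S x)
    cl? S x with r (x ∷ S) ℕ.≟ r S
    ... | no r≢ = no λ c → r≢ (rank-cong (λ { (here refl) → c ; (there s∈) → cl-∈ s∈ }) (cl-∈ ∘ there))
    ... | yes r≡ = yes (cl-stable λ x∉ → grow x∉ (r-attained S))
      where
      grow : ¬ Cl S x → (∃ λ T → T ⊆ S × length T ≡ r S × Ind T) → ⊥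
      grow x∉ (T , T⊆S , |T|≡rS , i) = ℕ.1+n≰n (begin
        suc (length T) ≤⟨ r-maximal (x ∷ S) (x ∷ T) (refl ∷ T⊆S) (x∉ ∘ cl-mono (Sublist.lookup T⊆S) , i) ⟩
        r (x ∷ S)      ≡⟨ r≡ ⟩
        r S            ≡⟨ |T|≡rS ⟨
        length T       ∎)
        where open ℕ.≤-Reasoning

-- Sums over subcollections and Whitney's broken-circuit theorem

∑ : ∀ {A : Set} → List A → (A → ℤ) → ℤ
∑ xs f = foldr ℤ._+_ 0ℤ (map f xs)

module _ {A : Set} where

  ∑-cong : ∀ (xs : List A) {f g} → (∀ {x} → x ∈ xs → f x ≡ g x) → ∑ xs f ≡ ∑ xs g
  ∑-cong []       h = refl
  ∑-cong (x ∷ xs) h = cong₂ ℤ._+_ (h (here refl)) (∑-cong xs (h ∘ there))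

  ∑-++ : ∀ (xs : List A) {ys} f → ∑ (xs ++ ys) f ≡ ∑ xs f ℤ.+ ∑ ys f
  ∑-++ []       f = sym (ℤ.+-identityˡ _)
  ∑-++ (x ∷ xs) f = trans (cong (λ z → f x ℤ.+ z) (∑-++ xs f)) (sym (ℤ.+-assoc (f x) _ _))

  ∑-map : ∀ {B : Set} (g : A → B) xs {f} → ∑ (map g xs) f ≡ ∑ xs (f ∘ g)
  ∑-map g []           = refl
  ∑-map g (x ∷ xs) {f} = cong (λ z → f (g x) ℤ.+ z) (∑-map g xs)

  ∑-0 : ∀ (xs : List A) → ∑ xs (λ _ → 0ℤ) ≡ 0ℤ
  ∑-0 []       = refl
  ∑-0 (x ∷ xs) = trans (ℤ.+-identityˡ _) (∑-0 xs)

  ∑-+ : ∀ (xs : List A) f g → ∑ xs (λ x → f x ℤ.+ g x) ≡ ∑ xs f ℤ.+ ∑ xs g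
  ∑-+ []       f g = refl
  ∑-+ (x ∷ xs) f g = trans (cong (λ z → f x ℤ.+ g x ℤ.+ z) (∑-+ xs f g)) (lemma (f x) (g x) _ _)
    where
    lemma : ∀ a b c d → (a ℤ.+ b) ℤ.+ (c ℤ.+ d) ≡ (a ℤ.+ c) ℤ.+ (b ℤ.+ d)
    lemma = solve-∀

  ∑-*ˡ : ∀ k (xs : List A) f → ∑ xs (λ x → k ℤ.* f x) ≡ k ℤ.* ∑ xs f
  ∑-*ˡ k []       f = sym (ℤ.*-zeroʳ k)
  ∑-*ˡ k (x ∷ xs) f = trans (cong (λ z → k ℤ.* f x ℤ.+ z) (∑-*ˡ k xs f)) (sym (ℤ.*-distribˡ-+ k _ _))

[_] : ∀ {P : Set} → Dec P → ℤ
[ p? ] = if does p? then 1ℤ else 0ℤ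

module _ {P : Set} where

  []-yes : (p? : Dec P) → P → [ p? ] ≡ 1ℤ
  []-yes (yes _) p = refl
  []-yes (no ¬p) p = contradiction p ¬p

  []-no : (p? : Dec P) → ¬ P → [ p? ] ≡ 0ℤ
  []-no (yes p) ¬p = contradiction p ¬p
  []-no (no _)  ¬p = refl

[]-cong : ∀ {P Q : Set} (p? : Dec P) (q? : Dec Q) → (P → Q) → (Q → P) → [ p? ] ≡ [ q? ]
[]-cong (yes p) q? f g = sym ([]-yes q? (f p))
[]-cong (no ¬p) q? f g = sym ([]-no q? (¬p ∘ g))

∈-subcollections⁻ : ∀ {A : Set} (L : List A) {S} → S ∈ subcollections L → S ⊆ L
∈-subcollections⁻ []      (here refl) = []
∈-subcollections⁻ (x ∷ L) S∈ with ∈-++⁻ (map (x ∷_) (subcollections L)) S∈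
... | inj₂ S∈L = x ∷ʳ ∈-subcollections⁻ L S∈L
... | inj₁ S∈L with ∈-map⁻ (x ∷_) S∈L
...   | T , T∈ , refl = refl ∷ ∈-subcollections⁻ L T∈

all-⊆ : ∀ {A : Set} {P : A → Set} {S L : List A} → S ⊆ L → All P L → All P S
all-⊆ []         ps       = ps
all-⊆ (_ ∷ʳ τ)   (_ ∷ ps) = all-⊆ τ ps
all-⊆ (refl ∷ τ) (p ∷ ps) = p ∷ all-⊆ τ ps

allPairs-⊆ : ∀ {A : Set} {R : A → A → Set} {S L : List A} → S ⊆ L → AllPairs R L → AllPairs R S
allPairs-⊆ []         rs       = rs
allPairs-⊆ (_ ∷ʳ τ)   (_ ∷ rs) = allPairs-⊆ τ rs
allPairs-⊆ (refl ∷ τ) (r ∷ rs) = all-⊆ τ r ∷ allPairs-⊆ τ rs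

signed : ∀ {A : Set} → List A → (List A → ℤ) → ℤ
signed L φ = ∑ (subcollections L) λ S → signPow (length S) ℤ.* φ S

-- A subcollection either omits `x` or contains it, in the latter case with the opposite sign.
signed-∷ : ∀ {A : Set} (x : A) L φ → signed (x ∷ L) φ ≡ signed L (λ S → φ S ℤ.- φ (x ∷ S))
signed-∷ x L φ = begin
  signed (x ∷ L) φ
    ≡⟨ ∑-++ (map (x ∷_) (subcollections L)) _ ⟩
  ∑ (map (x ∷_) (subcollections L)) _ ℤ.+ signed L φ
    ≡⟨ cong (ℤ._+ signed L φ) (∑-map (x ∷_) (subcollections L)) ⟩
  ∑ (subcollections L) (λ S → (-1ℤ ℤ.* signPow (length S)) ℤ.* φ (x ∷ S)) ℤ.+ signed L φ
    ≡⟨ ∑-+ (subcollections L) _ _ ⟨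
  ∑ (subcollections L) (λ S → (-1ℤ ℤ.* signPow (length S)) ℤ.* φ (x ∷ S) ℤ.+ signPow (length S) ℤ.* φ S)
    ≡⟨ ∑-cong (subcollections L) (λ {S} _ → trans
         (cong (λ s → s ℤ.* φ (x ∷ S) ℤ.+ signPow (length S) ℤ.* φ S) (ℤ.-1*i≡-i (signPow (length S))))
         (lemma (signPow (length S)) (φ S) (φ (x ∷ S)))) ⟩
  signed L (λ S → φ S ℤ.- φ (x ∷ S)) ∎
  where
  open ≡-Reasoning
  lemma : ∀ s p q → (ℤ.- s) ℤ.* q ℤ.+ s ℤ.* p ≡ s ℤ.* (p ℤ.- q)
  lemma = solve-∀

signed-cong : ∀ {A : Set} (L : List A) {φ ψ} → (∀ S → φ S ≡ ψ S) → signed L φ ≡ signed L ψ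
signed-cong L h = ∑-cong (subcollections L) λ {S} _ → cong (signPow (length S) ℤ.*_) (h S)

module Whitney {A : Set} (Cl : List A → A → Set)
  (cl-stable : ∀ {S x} → ¬ ¬ Cl S x → Cl S x)
  (cl-∈ : ∀ {S x} → x ∈ S → Cl S x)
  (cl-trans : ∀ {S T x} → Cl S x → (∀ {s} → s ∈ S → Cl T s) → Cl T x)
  (cl-exchange : ∀ {S x y} → Cl (x ∷ S) y → ¬ Cl S y → Cl (y ∷ S) x)
  (cl? : ∀ S x → Dec (Cl S x))
  where

  open Matroid Cl cl-stable cl-∈ cl-trans cl-exchange

  ClosureInvariant : (List A → ℤ) → Set
  ClosureInvariant φ = ∀ {S T} → S ≼ T → T ≼ S → φ S ≡ φ T

  contract : A → (List A → ℤ) → List A → ℤ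
  contract x φ S = φ S ℤ.- φ (x ∷ S)

  contract-inv : ∀ x {φ} → ClosureInvariant φ → ClosureInvariant (contract x φ)
  contract-inv x inv h h′ = cong₂ ℤ._-_ (inv h h′) (inv (≼-∷ x h) (≼-∷ x h′))

  -- `resonance` lists the sets in increasing order, whereas the broken-circuit argument needs a
  -- decreasing list. Reordering also permutes the members inside each subcollection, which closure
  -- invariance absorbs.
  signed-↭ : ∀ {L M} → L ↭ M → ∀ {φ} → ClosureInvariant φ → signed L φ ≡ signed M φ
  signed-↭ ↭.refl inv = refl
  signed-↭ {x ∷ L} {_ ∷ M} (↭.prep x p) {φ} inv = begin
    signed (x ∷ L) φ       ≡⟨ signed-∷ x L φ ⟩
    signed L (contract x φ) ≡⟨ signed-↭ p (contract-inv x inv) ⟩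
    signed M (contract x φ) ≡⟨ signed-∷ x M φ ⟨
    signed (x ∷ M) φ       ∎
    where open ≡-Reasoning
  signed-↭ {x ∷ y ∷ L} {_ ∷ _ ∷ M} (↭.swap x y p) {φ} inv = begin
    signed (x ∷ y ∷ L) φ               ≡⟨ signed-∷ x (y ∷ L) φ ⟩
    signed (y ∷ L) (contract x φ)       ≡⟨ signed-∷ y L (contract x φ) ⟩
    signed L (contract y (contract x φ)) ≡⟨ signed-↭ p (contract-inv y (contract-inv x inv)) ⟩
    signed M (contract y (contract x φ)) ≡⟨ signed-cong M (λ S → trans
      (cong (λ z → (φ S ℤ.- φ (x ∷ S)) ℤ.- (φ (y ∷ S) ℤ.- z)) (inv xy yx))
      (lemma (φ S) (φ (x ∷ S)) (φ (y ∷ S)) (φ (y ∷ x ∷ S)))) ⟩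
    signed M (contract x (contract y φ)) ≡⟨ signed-∷ x M (contract y φ) ⟨
    signed (x ∷ M) (contract y φ)       ≡⟨ signed-∷ y (x ∷ M) φ ⟨
    signed (y ∷ x ∷ M) φ               ∎
    where
    open ≡-Reasoning
    lemma : ∀ a b c d → (a ℤ.- b) ℤ.- (c ℤ.- d) ≡ (a ℤ.- c) ℤ.- (b ℤ.- d)
    lemma = solve-∀
    xy : ∀ {x y S} → (x ∷ y ∷ S) ≼ (y ∷ x ∷ S)
    xy = ≼-⊆ λ { (here e) → there (here e) ; (there (here e)) → here e ; (there (there s)) → there (there s) }
    yx : ∀ {x y S} → (x ∷ y ∷ S) ≼ (y ∷ x ∷ S)
    yx = xy
  signed-↭ (↭.trans p q) inv = trans (signed-↭ p inv) (signed-↭ q inv)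

  module _ (_≻_ : A → A → Set) (_≻?_ : ∀ x y → Dec (x ≻ y)) (≻-asym : ∀ {x y} → x ≻ y → ¬ y ≻ x) where

    -- No broken circuit: the members of L above the first member of a tail of S avoid the span of that tail.
    NBC : List A → List A → Set
    NBC L []      = All (λ y → ¬ Cl [] y) L
    NBC L (x ∷ S) = All (λ y → y ≻ x → ¬ Cl (x ∷ S) y) L × NBC L S

    nbc? : ∀ L S → Dec (NBC L S)
    nbc? L []      = All.all? (λ y → ¬? (cl? [] y)) L
    nbc? L (x ∷ S) = All.all? (λ y → (y ≻? x) →-dec ¬? (cl? (x ∷ S) y)) L ×-dec nbc? L S

    nbc-dropˡ : ∀ {y L} S → NBC (y ∷ L) S → NBC L S
    nbc-dropˡ []      (_ ∷ h)       = h
    nbc-dropˡ (x ∷ S) ((_ ∷ h) , k) = h , nbc-dropˡ S k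

    nbc-addˡ : ∀ {y L} S → ¬ Cl S y → NBC L S → NBC (y ∷ L) S
    nbc-addˡ []      y∉ h       = y∉ ∷ h
    nbc-addˡ (x ∷ S) y∉ (h , k) = ((λ _ → y∉) ∷ h) , nbc-addˡ S (y∉ ∘ cl-mono there) k

    -- As `y` is above all of `S`, the condition attached to the longest tail, `S` itself, already
    -- keeps `y` out of its span.
    nbc-top : ∀ {y L S} → All (y ≻_) S → NBC (y ∷ L) S → ¬ Cl S y
    nbc-top []        (y∉ ∷ _)       = y∉
    nbc-top (y≻x ∷ _) ((y∉ ∷ _) , _) = y∉ y≻x

    nbc-∷ : ∀ {y L S} → All (y ≻_) L → NBC (y ∷ L) S → NBC (y ∷ L) (y ∷ S)
    nbc-∷ {y} y≻L h = ((λ y≻y → contradiction y≻y (≻-asym y≻y)) ∷ All.map (λ y≻z z≻y → contradiction z≻y (≻-asym y≻z)) y≻L) , h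

    nbc-ind : ∀ {L S} → AllPairs _≻_ S → (∀ {s} → s ∈ S → s ∈ L) → NBC L S → Ind S
    nbc-ind {S = []} _ _ _ = tt
    nbc-ind {S = x ∷ []} (_ ∷ _) S⊆L (_ , h) = All.lookup h (S⊆L (here refl)) , tt
    nbc-ind {S = x ∷ y ∷ S} ((x≻y ∷ _) ∷ s) S⊆L (_ , h) =
      All.lookup (proj₁ h) (S⊆L (here refl)) x≻y , nbc-ind s (S⊆L ∘ there) h

    whitney : ∀ {L} → AllPairs _≻_ L → ∀ {φ} → ClosureInvariant φ →
      signed L φ ≡ signed L (λ S → [ nbc? L S ] ℤ.* φ S)
    whitney {[]} [] {φ} inv = cong (λ z → 1ℤ ℤ.* z ℤ.+ 0ℤ) (sym (ℤ.*-identityˡ (φ [])))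
    whitney {x ∷ L} (x≻L ∷ s) {φ} inv = begin
      signed (x ∷ L) φ                                       ≡⟨ signed-∷ x L φ ⟩
      signed L (contract x φ)                                ≡⟨ whitney s (contract-inv x inv) ⟩
      signed L (λ S → [ nbc? L S ] ℤ.* contract x φ S)       ≡⟨ ∑-cong (subcollections L) (λ {S} S∈ →
        cong (signPow (length S) ℤ.*_) (step S (all-⊆ (∈-subcollections⁻ L S∈) x≻L))) ⟩
      signed L (contract x (λ S → [ nbc? (x ∷ L) S ] ℤ.* φ S)) ≡⟨ signed-∷ x L _ ⟨
      signed (x ∷ L) (λ S → [ nbc? (x ∷ L) S ] ℤ.* φ S)      ∎
      where
      open ≡-Reasoning
      step : ∀ S → All (x ≻_) S → [ nbc? L S ] ℤ.* contract x φ S ≡ contract x (λ S → [ nbc? (x ∷ L) S ] ℤ.* φ S) S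
      step S x≻S with cl? S x
      -- `x` is spanned by `S`: the two values of `φ` agree, and neither `S` nor `x ∷ S` is free of
      -- broken circuits once `x` belongs to the ground list.
      ... | yes c = begin
        [ nbc? L S ] ℤ.* (φ S ℤ.- φ (x ∷ S))
          ≡⟨ cong (λ z → [ nbc? L S ] ℤ.* (φ S ℤ.- z))
               (inv (λ { (here refl) → c ; (there s∈) → cl-∈ s∈ }) (cl-∈ ∘ there)) ⟩
        [ nbc? L S ] ℤ.* (φ S ℤ.- φ S)
          ≡⟨ lemma [ nbc? L S ] (φ S) (φ (x ∷ S)) ⟩
        0ℤ ℤ.* φ S ℤ.- 0ℤ ℤ.* φ (x ∷ S)
          ≡⟨ cong₂ (λ u v → u ℤ.* φ S ℤ.- v ℤ.* φ (x ∷ S))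
               ([]-no (nbc? (x ∷ L) S) (λ h → nbc-top x≻S h c))
               ([]-no (nbc? (x ∷ L) (x ∷ S)) (λ h → nbc-top x≻S (proj₂ h) c)) ⟨
        contract x (λ S → [ nbc? (x ∷ L) S ] ℤ.* φ S) S ∎
        where
        lemma : ∀ a b c → a ℤ.* (b ℤ.- b) ≡ 0ℤ ℤ.* b ℤ.- 0ℤ ℤ.* c
        lemma = solve-∀
      -- `x` is not spanned by `S` and is above everything in sight, so adding it to the ground
      -- list, or to `S` as well, creates no broken circuit.
      ... | no x∉ = begin
        [ nbc? L S ] ℤ.* (φ S ℤ.- φ (x ∷ S))
          ≡⟨ lemma [ nbc? L S ] (φ S) (φ (x ∷ S)) ⟩
        [ nbc? L S ] ℤ.* φ S ℤ.- [ nbc? L S ] ℤ.* φ (x ∷ S)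
          ≡⟨ cong₂ (λ u v → u ℤ.* φ S ℤ.- v ℤ.* φ (x ∷ S))
               ([]-cong (nbc? L S) (nbc? (x ∷ L) S) (nbc-addˡ S x∉) (nbc-dropˡ S))
               ([]-cong (nbc? L S) (nbc? (x ∷ L) (x ∷ S)) (nbc-∷ x≻L ∘ nbc-addˡ S x∉) (nbc-dropˡ S ∘ proj₂)) ⟩
        contract x (λ S → [ nbc? (x ∷ L) S ] ℤ.* φ S) S ∎
        where
        lemma : ∀ a b c → a ℤ.* (b ℤ.- c) ≡ a ℤ.* b ℤ.- a ℤ.* c
        lemma = solve-∀

    -- Collections free of broken circuits are independent, so their rank is their size and all
    -- surviving terms carry the same sign.
    signed-rank : ∀ (r : List A → ℕ) → (∀ {S T} → S ≼ T → T ≼ S → r S ≡ r T) → (∀ {S} → Ind S → r S ≡ length S) →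
      ∀ {L} → AllPairs _≻_ L → ∀ i →
      signed L (λ S → [ r S ℕ.≟ i ]) ≡ signPow i ℤ.* ∑ (subcollections L) (λ S → [ length S ℕ.≟ i ] ℤ.* [ nbc? L S ])
    signed-rank r r-cong r-ind {L} sorted i = begin
      signed L (λ S → [ r S ℕ.≟ i ])
        ≡⟨ whitney sorted (λ h h′ → cong (λ k → [ k ℕ.≟ i ]) (r-cong h h′)) ⟩
      signed L (λ S → [ nbc? L S ] ℤ.* [ r S ℕ.≟ i ])
        ≡⟨ ∑-cong (subcollections L) (λ {S} S∈ → step S (∈-subcollections⁻ L S∈)) ⟩
      ∑ (subcollections L) (λ S → signPow i ℤ.* ([ length S ℕ.≟ i ] ℤ.* [ nbc? L S ]))
        ≡⟨ ∑-*ˡ (signPow i) (subcollections L) _ ⟩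
      signPow i ℤ.* ∑ (subcollections L) (λ S → [ length S ℕ.≟ i ] ℤ.* [ nbc? L S ]) ∎
      where
      open ≡-Reasoning
      step : ∀ S → S ⊆ L → signPow (length S) ℤ.* ([ nbc? L S ] ℤ.* [ r S ℕ.≟ i ])
        ≡ signPow i ℤ.* ([ length S ℕ.≟ i ] ℤ.* [ nbc? L S ])
      step S S⊆L with nbc? L S
      ... | no _ = trans (lemma (signPow (length S)) [ r S ℕ.≟ i ] (signPow i) [ length S ℕ.≟ i ]) refl
        where
        lemma : ∀ a b c d → a ℤ.* (0ℤ ℤ.* b) ≡ c ℤ.* (d ℤ.* 0ℤ)
        lemma = solve-∀
      ... | yes h rewrite r-ind (nbc-ind (allPairs-⊆ S⊆L sorted) (Sublist.lookup S⊆L) h) = sized (length S ℕ.≟ i)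
        where
        sized : ∀ {m} (d : Dec (m ≡ i)) → signPow m ℤ.* (1ℤ ℤ.* [ d ]) ≡ signPow i ℤ.* ([ d ] ℤ.* 1ℤ)
        sized (yes refl) = refl
        sized {m} (no _) = trans (ℤ.*-zeroʳ (signPow m)) (sym (ℤ.*-zeroʳ (signPow i)))

∑₂ : ∀ {A : Set} → List A → (A → A → ℤ) → ℤ
∑₂ []      f = 0ℤ
∑₂ (x ∷ L) f = ∑ L (f x) ℤ.+ ∑₂ L f

∑₃ : ∀ {A : Set} → List A → (A → A → A → ℤ) → ℤ
∑₃ []      f = 0ℤ
∑₃ (x ∷ L) f = ∑₂ L (f x) ℤ.+ ∑₃ L f

∑-size : ∀ {A : Set} → ℕ → List A → (List A → ℤ) → ℤ
∑-size k L F = ∑ (subcollections L) λ S → [ length S ℕ.≟ k ] ℤ.* F S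

module _ {A : Set} where

  ∑-size-zero : ∀ (L : List A) F → ∑-size 0 L F ≡ F []
  ∑-size-zero []      F = trans (ℤ.+-identityʳ _) (ℤ.*-identityˡ (F []))
  ∑-size-zero (x ∷ L) F = begin
    ∑-size 0 (x ∷ L) F
      ≡⟨ ∑-++ (map (x ∷_) (subcollections L)) _ ⟩
    ∑ (map (x ∷_) (subcollections L)) _ ℤ.+ ∑-size 0 L F
      ≡⟨ cong₂ ℤ._+_ (trans (∑-map (x ∷_) (subcollections L)) (∑-0 (subcollections L))) (∑-size-zero L F) ⟩
    0ℤ ℤ.+ F []
      ≡⟨ ℤ.+-identityˡ (F []) ⟩
    F [] ∎
    where open ≡-Reasoning

  ∑-size-suc : ∀ k x (L : List A) F → ∑-size (suc k) (x ∷ L) F ≡ ∑-size k L (F ∘ (x ∷_)) ℤ.+ ∑-size (suc k) L F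
  ∑-size-suc k x L F = trans (∑-++ (map (x ∷_) (subcollections L)) _)
    (cong (ℤ._+ ∑-size (suc k) L F) (∑-map (x ∷_) (subcollections L)))

  ∑-size-1 : ∀ (L : List A) F → ∑-size 1 L F ≡ ∑ L (λ a → F (a ∷ []))
  ∑-size-1 []      F = refl
  ∑-size-1 (x ∷ L) F = trans (∑-size-suc 0 x L F) (cong₂ ℤ._+_ (∑-size-zero L _) (∑-size-1 L F))

  ∑-size-2 : ∀ (L : List A) F → ∑-size 2 L F ≡ ∑₂ L (λ a b → F (a ∷ b ∷ []))
  ∑-size-2 []      F = refl
  ∑-size-2 (x ∷ L) F = trans (∑-size-suc 1 x L F) (cong₂ ℤ._+_ (∑-size-1 L _) (∑-size-2 L F))

  ∑-size-3 : ∀ (L : List A) F → ∑-size 3 L F ≡ ∑₃ L (λ a b c → F (a ∷ b ∷ c ∷ []))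
  ∑-size-3 []      F = refl
  ∑-size-3 (x ∷ L) F = trans (∑-size-suc 2 x L F) (cong₂ ℤ._+_ (∑-size-2 L _) (∑-size-3 L F))

-- Linear spans over ℚ

Span : ∀ {n} → List (Fin n → ℚ) → (Fin n → ℚ) → Set
Span vs v = ∃ λ c → ∀ i → v i ≡ linComb c vs i

module _ {n : ℕ} where
  open ℚSolver.+-*-Solver using (solve; con; _:+_; _:*_; :-_; _:=_)

  addCoeffs : List ℚ → List ℚ → List ℚ
  addCoeffs []      d       = d
  addCoeffs (x ∷ c) []      = x ∷ c
  addCoeffs (x ∷ c) (y ∷ d) = x ℚ.+ y ∷ addCoeffs c d

  linComb-add : ∀ c d (vs : List (Fin n → ℚ)) i →
    linComb (addCoeffs c d) vs i ≡ linComb c vs i ℚ.+ linComb d vs i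
  linComb-add []      d       vs       i = sym (ℚ.+-identityˡ _)
  linComb-add (x ∷ c) []      vs       i = sym (ℚ.+-identityʳ _)
  linComb-add (x ∷ c) (y ∷ d) []       i = refl
  linComb-add (x ∷ c) (y ∷ d) (v ∷ vs) i
    rewrite linComb-add c d vs i =
    solve 5 (λ x y v p q → (x :+ y) :* v :+ (p :+ q) := (x :* v :+ p) :+ (y :* v :+ q)) refl
      x y (v i) (linComb c vs i) (linComb d vs i)

  linComb-scale : ∀ k c (vs : List (Fin n → ℚ)) i →
    linComb (map (k ℚ.*_) c) vs i ≡ k ℚ.* linComb c vs i
  linComb-scale k []      vs       i = sym (ℚ.*-zeroʳ k)
  linComb-scale k (x ∷ c) []       i = sym (ℚ.*-zeroʳ k)
  linComb-scale k (x ∷ c) (v ∷ vs) i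
    rewrite linComb-scale k c vs i =
    solve 4 (λ k x v p → (k :* x) :* v :+ k :* p := k :* (x :* v :+ p)) refl
      k x (v i) (linComb c vs i)

  span-axpy : ∀ {vs v w} k → Span vs v → Span vs w → Span {n} vs (λ i → k ℚ.* v i ℚ.+ w i)
  span-axpy {vs} k (c , p) (d , q) = addCoeffs (map (k ℚ.*_) c) d , λ i → sym
    (trans (linComb-add (map (k ℚ.*_) c) d vs i)
    (cong₂ ℚ._+_ (trans (linComb-scale k c vs i) (cong (k ℚ.*_) (sym (p i)))) (sym (q i))))

  span-resp : ∀ {vs v w} → (∀ i → w i ≡ v i) → Span vs v → Span {n} vs w
  span-resp e (c , p) = c , λ i → trans (e i) (p i)

  span-weaken : ∀ {vs v} u → Span vs v → Span {n} (u ∷ vs) v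
  span-weaken {vs} u (c , p) = 0ℚ ∷ c , λ i → trans (p i)
    (solve 2 (λ u x → x := con 0ℚ :* u :+ x) refl (u i) (linComb c vs i))

  span-head : ∀ {vs} u → Span {n} (u ∷ vs) u
  span-head u = 1ℚ ∷ [] , λ i → solve 1 (λ u → u := con 1ℚ :* u :+ con 0ℚ) refl (u i)

  span-∈ : ∀ {vs v} → v ∈ vs → Span {n} vs v
  span-∈ {v ∷ _} (here refl) = span-head v
  span-∈ {u ∷ _} (there v∈)  = span-weaken u (span-∈ v∈)

  span-linComb : ∀ {ws} c vs → (∀ {u} → u ∈ vs → Span ws u) → Span {n} ws (linComb c vs)
  span-linComb []      vs       h = [] , λ i → refl
  span-linComb (x ∷ c) []       h = [] , λ i → refl
  span-linComb (x ∷ c) (v ∷ vs) h = span-axpy x (h (here refl)) (span-linComb c vs (h ∘ there))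

  span-trans : ∀ {vs ws v} → Span vs v → (∀ {u} → u ∈ vs → Span ws u) → Span {n} ws v
  span-trans {vs} (c , p) h = span-resp p (span-linComb c vs h)

  span-exchange : ∀ {vs u v} → Span (u ∷ vs) v → ¬ Span vs v → Span {n} (v ∷ vs) u
  span-exchange ([] , p) v∉ = contradiction ([] , p) v∉
  span-exchange {vs} {u} {v} (x ∷ c , p) v∉ with x ℚ.≟ 0ℚ
  ... | yes refl = contradiction
    (c , λ i → trans (p i) (solve 2 (λ u x → con 0ℚ :* u :+ x := x) refl (u i) (linComb c vs i))) v∉
  ... | no x≢0 = (1/x ∷ map ((ℚ.- 1/x) ℚ.*_) c) , λ i → begin
      u i
        ≡⟨ ℚ.*-identityˡ (u i) ⟨
      1ℚ ℚ.* u i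
        ≡⟨ cong (ℚ._* u i) (ℚ.*-inverseˡ x) ⟨
      1/x ℚ.* x ℚ.* u i
        ≡⟨ solve 4 (λ r x u l → r :* x :* u := r :* (x :* u :+ l) :+ (:- r) :* l) refl
             1/x x (u i) (linComb c vs i) ⟩
      1/x ℚ.* (x ℚ.* u i ℚ.+ linComb c vs i) ℚ.+ (ℚ.- 1/x) ℚ.* linComb c vs i
        ≡⟨ cong₂ ℚ._+_ (cong (1/x ℚ.*_) (sym (p i))) (sym (linComb-scale (ℚ.- 1/x) c vs i)) ⟩
      1/x ℚ.* v i ℚ.+ linComb (map ((ℚ.- 1/x) ℚ.*_) c) vs i ∎
    where
    open ≡-Reasoning
    instance _ = ℚ.≢-nonZero x≢0
    1/x = ℚ.1/ x

  -- `LinIndep` tests coefficient lists of matching length, while `Span` admits any length.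
  -- `linComb` reads missing coefficients as 0 and drops surplus ones, so padding and truncating
  -- preserve its value.
  fit : List ℚ → List (Fin n → ℚ) → List ℚ
  fit c       []       = []
  fit []      (v ∷ vs) = 0ℚ ∷ fit [] vs
  fit (x ∷ c) (v ∷ vs) = x ∷ fit c vs

  length-fit : ∀ c vs → length (fit c vs) ≡ length vs
  length-fit c       []       = refl
  length-fit []      (v ∷ vs) = cong suc (length-fit [] vs)
  length-fit (x ∷ c) (v ∷ vs) = cong suc (length-fit c vs)

  linComb-fit : ∀ c vs i → linComb (fit c vs) vs i ≡ linComb c vs i
  linComb-fit []      []       i = refl
  linComb-fit (x ∷ c) []       i = refl
  linComb-fit []      (v ∷ vs) i rewrite linComb-fit [] vs i =
    solve 1 (λ v → con 0ℚ :* v :+ con 0ℚ := con 0ℚ) refl (v i)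
  linComb-fit (x ∷ c) (v ∷ vs) i = cong (x ℚ.* v i ℚ.+_) (linComb-fit c vs i)

  linIndep-[] : LinIndep {n} []
  linIndep-[] [] refl _ = []

  linIndep-∷ : ∀ {v vs} → ¬ Span vs v → LinIndep vs → LinIndep {n} (v ∷ vs)
  linIndep-∷ {v} {vs} v∉ ind (x ∷ c) len eq with x ℚ.≟ 0ℚ
  ... | yes refl = refl ∷ ind c (ℕ.suc-injective len) λ i → trans
    (solve 2 (λ u x → x := con 0ℚ :* u :+ x) refl (v i) (linComb c vs i)) (eq i)
  ... | no x≢0 = contradiction
    (map ((ℚ.- 1/x) ℚ.*_) c , λ i → begin
      v i
        ≡⟨ ℚ.*-identityˡ (v i) ⟨
      1ℚ ℚ.* v i
        ≡⟨ cong (ℚ._* v i) (ℚ.*-inverseˡ x) ⟨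
      1/x ℚ.* x ℚ.* v i
        ≡⟨ solve 4 (λ r x u l → r :* x :* u := r :* (x :* u :+ l) :+ (:- r) :* l) refl
             1/x x (v i) (linComb c vs i) ⟩
      1/x ℚ.* (x ℚ.* v i ℚ.+ linComb c vs i) ℚ.+ (ℚ.- 1/x) ℚ.* linComb c vs i
        ≡⟨ cong₂ ℚ._+_ (trans (cong (1/x ℚ.*_) (eq i)) (ℚ.*-zeroʳ 1/x)) (sym (linComb-scale (ℚ.- 1/x) c vs i)) ⟩
      0ℚ ℚ.+ linComb (map ((ℚ.- 1/x) ℚ.*_) c) vs i
        ≡⟨ ℚ.+-identityˡ _ ⟩
      linComb (map ((ℚ.- 1/x) ℚ.*_) c) vs i ∎) v∉
    where
    open ≡-Reasoning
    instance _ = ℚ.≢-nonZero x≢0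
    1/x = ℚ.1/ x

  linIndep-tail : ∀ {v vs} → LinIndep {n} (v ∷ vs) → LinIndep vs
  linIndep-tail {v} {vs} ind c len eq = All.tail (ind (0ℚ ∷ c) (cong suc len) λ i → trans
    (solve 2 (λ u x → con 0ℚ :* u :+ x := x) refl (v i) (linComb c vs i)) (eq i))

  -- Moving `v` to the other side gives a relation with leading coefficient -1.
  linIndep-head : ∀ {v vs} → LinIndep {n} (v ∷ vs) → ¬ Span vs v
  linIndep-head {v} {vs} ind (c , p) = -1≢0 (All.head
    (ind ((ℚ.- 1ℚ) ∷ fit c vs) (cong suc (length-fit c vs)) λ i → trans
      (cong₂ (λ x y → (ℚ.- 1ℚ) ℚ.* x ℚ.+ y) (p i) (linComb-fit c vs i))
      (solve 1 (λ l → con (ℚ.- 1ℚ) :* l :+ l := con 0ℚ) refl (linComb c vs i))))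
    where
    -1≢0 : ℚ.- 1ℚ ≢ 0ℚ
    -1≢0 ()

-- Double negation makes membership in the span stable; every use of it ends in a decidable statement.
record Cl {n} (S : List (Subset n)) (x : Subset n) : Set where
  constructor closure
  field ¬¬-span : ¬ ¬ Span (map normal S) (normal x)
open Cl public

cl-stable : ∀ {n S} {x : Subset n} → ¬ ¬ Cl S x → Cl S x
cl-stable nn = closure λ ns → nn λ c → ¬¬-span c ns

cl-∈ : ∀ {n S} {x : Subset n} → x ∈ S → Cl S x
cl-∈ x∈ = closure λ ns → ns (span-∈ (∈-map⁺ normal x∈))

-- Double negation commutes with quantification over a finite list; transitivity of the closure
-- needs the coefficients of all generators at once.
¬¬-all : ∀ {A : Set} {P : A → Set} (xs : List A) → (∀ {x} → x ∈ xs → ¬ ¬ P x) → ¬ ¬ (∀ {x} → x ∈ xs → P x)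
¬¬-all []       h k = k λ ()
¬¬-all (x ∷ xs) h k = h (here refl) λ px → ¬¬-all xs (h ∘ there) λ pxs →
  k λ { (here refl) → px ; (there x∈) → pxs x∈ }

cl-trans : ∀ {n S T} {x : Subset n} → Cl S x → (∀ {s} → s ∈ S → Cl T s) → Cl T x
cl-trans {n} {S} {T} cx h = closure λ ns → ¬¬-span cx λ sx → ¬¬-all S (¬¬-span ∘ h) λ h′ →
  ns (span-trans sx λ u∈ → via (∈-map⁻ normal u∈) h′)
  where
  via : ∀ {u : Fin n → ℚ} → (∃ λ s → s ∈ S × u ≡ normal s) → (∀ {s} → s ∈ S → Span (map normal T) (normal s)) → Span (map normal T) u
  via (s , s∈ , refl) h′ = h′ s∈

cl-exchange : ∀ {n S} {x y : Subset n} → Cl (x ∷ S) y → ¬ Cl S y → Cl (y ∷ S) x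
cl-exchange cy y∉ = closure λ ns → ¬¬-span cy λ sy → ns (span-exchange sy λ s → y∉ (closure λ k → k s))

-- Circuits of size at most four in the resonance arrangement

data _≻_ : ∀ {n} → Subset n → Subset n → Set where
  top  : ∀ {n} {a b : Subset n} → (true ∷ a) ≻ (false ∷ b)
  next : ∀ {n x} {a b : Subset n} → a ≻ b → (x ∷ a) ≻ (x ∷ b)

_≻?_ : ∀ {n} (a b : Subset n) → Dec (a ≻ b)
[]          ≻? []          = no λ ()
(true ∷ a)  ≻? (false ∷ b) = yes top
(false ∷ a) ≻? (true ∷ b)  = no λ ()
(true ∷ a)  ≻? (true ∷ b)  = map′ next (λ { (next h) → h }) (a ≻? b)
(false ∷ a) ≻? (false ∷ b) = map′ next (λ { (next h) → h }) (a ≻? b)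

≻-asym : ∀ {n} {a b : Subset n} → a ≻ b → ¬ b ≻ a
≻-asym top      ()
≻-asym (next h) (next k) = ≻-asym h k

≻-trans : ∀ {n} {a b c : Subset n} → a ≻ b → b ≻ c → a ≻ c
≻-trans top      (next k) = top
≻-trans (next h) top      = top
≻-trans (next h) (next k) = next (≻-trans h k)

≻-witness : ∀ {n} {a b : Subset n} → a ≻ b → ∃ λ i → lookup a i ≡ true × lookup b i ≡ false
≻-witness top      = zero , refl , refl
≻-witness (next h) with ≻-witness h
... | i , p , q = suc i , p , q

⊆⇒⊁ : ∀ {n} {a b : Subset n} → (∀ i → lookup a i ≡ true → lookup b i ≡ true) → ¬ a ≻ b
⊆⇒⊁ sub a≻b with ≻-witness a≻b
... | i , p , q with trans (sym q) (sub i p)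
...   | ()

⊋⇒≻ : ∀ {n} {a b : Subset n} → (∀ i → lookup b i ≡ true → lookup a i ≡ true) →
  (∃ λ i → lookup a i ≡ true × lookup b i ≡ false) → a ≻ b
⊋⇒≻ {a = []}        {[]}        sub (() , _)
⊋⇒≻ {a = true ∷ a}  {false ∷ b} sub w = top
⊋⇒≻ {a = false ∷ a} {true ∷ b}  sub w with () ← sub zero refl
⊋⇒≻ {a = true ∷ a}  {true ∷ b}  sub (suc i , w) = next (⊋⇒≻ (sub ∘ suc) (i , w))
⊋⇒≻ {a = false ∷ a} {false ∷ b} sub (suc i , w) = next (⊋⇒≻ (sub ∘ suc) (i , w))

bit : Bool → ℕ
bit b = if b then 1 else 0

-- Read in binary, the hypothesis says y + c = a + b.
≻-shift : ∀ {n} {a b c y : Subset n} →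
  (∀ i → bit (lookup y i) ℕ.+ bit (lookup c i) ≡ bit (lookup a i) ℕ.+ bit (lookup b i)) → b ≻ c → y ≻ a
≻-shift {a = true  ∷ a} {y = true  ∷ y} e top with () ← e zero
≻-shift {a = true  ∷ a} {y = false ∷ y} e top with () ← e zero
≻-shift {a = false ∷ a} {y = true  ∷ y} e top = top
≻-shift {a = false ∷ a} {y = false ∷ y} e top with () ← e zero
≻-shift {a = true  ∷ a} {y = true  ∷ y} e (next h) = next (≻-shift (e ∘ suc) h)
≻-shift {a = false ∷ a} {y = false ∷ y} e (next h) = next (≻-shift (e ∘ suc) h)
≻-shift {a = true  ∷ a} {y = false ∷ y} e (next {x = true}  h) with () ← e zero
≻-shift {a = true  ∷ a} {y = false ∷ y} e (next {x = false} h) with () ← e zero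
≻-shift {a = false ∷ a} {y = true  ∷ y} e (next {x = true}  h) with () ← e zero
≻-shift {a = false ∷ a} {y = true  ∷ y} e (next {x = false} h) with () ← e zero

disjoint : ∀ {n} → Subset n → Subset n → Bool
disjoint []      []      = true
disjoint (x ∷ a) (y ∷ b) = not (x ∧ y) ∧ disjoint a b

all₃ : ∀ {n} → (Bool → Bool → Bool → Bool) → Subset n → Subset n → Subset n → Bool
all₃ p []      []      []      = true
all₃ p (x ∷ a) (y ∷ b) (z ∷ c) = p x y z ∧ all₃ p a b c

∧-true : ∀ {x y} → x ∧ y ≡ true → x ≡ true × y ≡ true
∧-true {true} {true} refl = refl , refl

disjoint-true : ∀ {n} (a b : Subset n) → disjoint a b ≡ true → ∀ i → not (lookup a i ∧ lookup b i) ≡ true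
disjoint-true (x ∷ a) (y ∷ b) h zero    = proj₁ (∧-true h)
disjoint-true (x ∷ a) (y ∷ b) h (suc i) = disjoint-true a b (proj₂ (∧-true {not (x ∧ y)} h)) i

disjoint-false : ∀ {n} (a b : Subset n) → disjoint a b ≡ false → ∃ λ i → lookup a i ≡ true × lookup b i ≡ true
disjoint-false []          []          ()
disjoint-false (true  ∷ a) (true  ∷ b) h = zero , refl , refl
disjoint-false (true  ∷ a) (false ∷ b) h with disjoint-false a b h
... | i , p , q = suc i , p , q
disjoint-false (false ∷ a) (_     ∷ b) h with disjoint-false a b h
... | i , p , q = suc i , p , q

all₃-true : ∀ {n} p (a b c : Subset n) → all₃ p a b c ≡ true → ∀ i → p (lookup a i) (lookup b i) (lookup c i) ≡ true
all₃-true p (x ∷ a) (y ∷ b) (z ∷ c) h zero    = proj₁ (∧-true h)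
all₃-true p (x ∷ a) (y ∷ b) (z ∷ c) h (suc i) = all₃-true p a b c (proj₂ (∧-true {p x y z} h)) i

all₃-false : ∀ {n} p (a b c : Subset n) → all₃ p a b c ≡ false → ∃ λ i → p (lookup a i) (lookup b i) (lookup c i) ≡ false
all₃-false p []      []      []      ()
all₃-false p (x ∷ a) (y ∷ b) (z ∷ c) h with p x y z in eq
... | false = zero , eq
... | true with all₃-false p a b c h
...   | i , q = suc i , q

-- a ∩ b ⊆ c ⊆ a ∪ b, that is, a + b − c is the indicator vector of a set
between : Bool → Bool → Bool → Bool
between true  true  z = z
between false false z = not z
between _     _     z = true

-- (a + b + c)/2 is the indicator vector of a set
evenly : Bool → Bool → Bool → Bool
evenly true  y z = (y ∧ not z) ∨ (z ∧ not y)
evenly false y z = (y ∧ z) ∨ (not y ∧ not z)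

⟦_⟧ : Bool → ℚ
⟦ b ⟧ = if b then 1ℚ else 0ℚ

𝔹-all? : ∀ {P : Bool → Set} → (∀ b → Dec (P b)) → Dec (∀ b → P b)
𝔹-all? P? = map′ (λ { (t , f) true → t ; (t , f) false → f }) (λ h → h true , h false) (P? true ×-dec P? false)

val : ℚ → ℚ → ℚ → Bool → Bool → Bool → ℚ
val α β γ x y z = α ℚ.* ⟦ x ⟧ ℚ.+ (β ℚ.* ⟦ y ⟧ ℚ.+ (γ ℚ.* ⟦ z ⟧ ℚ.+ 0ℚ))

letters? : ∀ α β γ {P : Bool → Bool → Bool → Bool → Set} → (∀ x y z w → Dec (P x y z w)) →
  Dec (∀ x y z w → ⟦ w ⟧ ≡ val α β γ x y z → P x y z w)
letters? α β γ P? = 𝔹-all? λ x → 𝔹-all? λ y → 𝔹-all? λ z → 𝔹-all? λ w →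
  (⟦ w ⟧ ℚ.≟ val α β γ x y z) →-dec P? x y z w

Is01 : ℚ → Set
Is01 q = q ≡ 0ℚ ⊎ q ≡ 1ℚ

is01-⟦⟧ : ∀ b {q} → ⟦ b ⟧ ≡ q → Is01 q
is01-⟦⟧ true  e = inj₂ (sym e)
is01-⟦⟧ false e = inj₁ (sym e)

-1ℚ 2ℚ -2ℚ 3ℚ : ℚ
-1ℚ = ℚ.- 1ℚ
2ℚ  = 1ℚ ℚ.+ 1ℚ
-2ℚ = ℚ.- 2ℚ
3ℚ  = 1ℚ ℚ.+ 2ℚ

module _ where
  open ℚSolver.+-*-Solver using (solve; con; _:+_; _:*_; :-_; _:=_)

  val-100 : ∀ α β γ → val α β γ true false false ≡ α
  val-100 = solve 3 (λ α β γ → α :* con 1ℚ :+ (β :* con 0ℚ :+ (γ :* con 0ℚ :+ con 0ℚ)) := α) refl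
  val-010 : ∀ α β γ → val α β γ false true false ≡ β
  val-010 = solve 3 (λ α β γ → α :* con 0ℚ :+ (β :* con 1ℚ :+ (γ :* con 0ℚ :+ con 0ℚ)) := β) refl
  val-001 : ∀ α β γ → val α β γ false false true ≡ γ
  val-001 = solve 3 (λ α β γ → α :* con 0ℚ :+ (β :* con 0ℚ :+ (γ :* con 1ℚ :+ con 0ℚ)) := γ) refl
  val-110 : ∀ α β γ → val α β γ true true false ≡ α ℚ.+ β
  val-110 = solve 3 (λ α β γ → α :* con 1ℚ :+ (β :* con 1ℚ :+ (γ :* con 0ℚ :+ con 0ℚ)) := α :+ β) refl
  val-101 : ∀ α β γ → val α β γ true false true ≡ α ℚ.+ γ
  val-101 = solve 3 (λ α β γ → α :* con 1ℚ :+ (β :* con 0ℚ :+ (γ :* con 1ℚ :+ con 0ℚ)) := α :+ γ) refl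
  val-011 : ∀ α β γ → val α β γ false true true ≡ β ℚ.+ γ
  val-011 = solve 3 (λ α β γ → α :* con 0ℚ :+ (β :* con 1ℚ :+ (γ :* con 1ℚ :+ con 0ℚ)) := β :+ γ) refl
  val-111 : ∀ α β γ → val α β γ true true true ≡ α ℚ.+ β ℚ.+ γ
  val-111 = solve 3 (λ α β γ → α :* con 1ℚ :+ (β :* con 1ℚ :+ (γ :* con 1ℚ :+ con 0ℚ)) := α :+ β :+ γ) refl

  cancel : ∀ x y {s} → x ℚ.+ y ≡ s → x ≡ s ℚ.- y
  cancel x y refl = solve 2 (λ x y → x := x :+ y :+ (:- y)) refl x y

nonzero-01 : ∀ {x} → Is01 x → x ≢ 0ℚ → x ≡ 1ℚ
nonzero-01 (inj₁ z) x≢0 = contradiction z x≢0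
nonzero-01 (inj₂ e) x≢0 = e

IsUnit : ℚ → Set
IsUnit x = x ≡ 1ℚ ⊎ x ≡ -1ℚ

unit-diff : ∀ x y → Is01 (x ℚ.+ y) → Is01 y → x ≢ 0ℚ → IsUnit x
unit-diff x y (inj₁ s) (inj₁ refl) x≢0 = contradiction (cancel x y s) x≢0
unit-diff x y (inj₁ s) (inj₂ refl) x≢0 = inj₂ (cancel x y s)
unit-diff x y (inj₂ s) (inj₁ refl) x≢0 = inj₁ (cancel x y s)
unit-diff x y (inj₂ s) (inj₂ refl) x≢0 = contradiction (cancel x y s) x≢0

-- `x` must be 1, so `y` and `z` are both -1, and their sum -2 is no indicator value.
no-private : ∀ {x y z} → x ≢ 0ℚ → y ≢ 0ℚ → z ≢ 0ℚ →
  Is01 x → Is01 (y ℚ.+ x) → Is01 (z ℚ.+ x) → Is01 (y ℚ.+ z) → ⊥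
no-private {x} {y} {z} x≢0 y≢0 z≢0 hx hyx hzx hyz with nonzero-01 hx x≢0
... | refl with minus y≢0 hyx | minus z≢0 hzx
  where
  minus : ∀ {t} → t ≢ 0ℚ → Is01 (t ℚ.+ 1ℚ) → t ≡ -1ℚ
  minus {t} t≢0 (inj₁ e) = cancel t 1ℚ e
  minus {t} t≢0 (inj₂ e) = contradiction (cancel t 1ℚ e) t≢0
...   | refl | refl with hyz
...     | inj₁ ()
...     | inj₂ ()

Meet : ∀ {n} → Subset n → Subset n → Set
Meet a b = ∃ λ i → lookup a i ≡ true × lookup b i ≡ true

record Combines {n} (α β γ : ℚ) (a b c y : Subset n) : Set where
  constructor combines
  field coord : ∀ i → ⟦ lookup y i ⟧ ≡ val α β γ (lookup a i) (lookup b i) (lookup c i)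
open Combines

-- Once the coefficients are numerals, a claim about a single column is a check of 16 cases, which
-- the implicit `True` argument carries out during type checking.
letterwise : ∀ {n} α β γ {P : Bool → Bool → Bool → Bool → Set} (P? : ∀ x y z w → Dec (P x y z w)) →
  {True (letters? α β γ P?)} → ∀ {a b c y : Subset n} → Combines α β γ a b c y →
  ∀ i → P (lookup a i) (lookup b i) (lookup c i) (lookup y i)
letterwise α β γ P? {t} {a} {b} {c} {y} eq i =
  toWitness t (lookup a i) (lookup b i) (lookup c i) (lookup y i) (coord eq i)

_⇒?_ : ∀ x y → Dec (x ≡ true → y ≡ true)
x ⇒? y = (x 𝔹.≟ true) →-dec (y 𝔹.≟ true)

-- The first set is irrelevant: its coefficient is zero.
pair-combination : ∀ {n} β γ {a b c y : Subset n} → y ≻ b → b ≻ c → Meet b c → ¬ Combines 0ℚ β γ a b c y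
pair-combination β γ {a} {b} {c} {y} y≻b b≻c (j , bj , cj) eq with ≻-witness b≻c
... | i , bi , ci = go γ (is01-⟦⟧ (lookup y i) (trans (coord eq i) (at-10 (lookup a i) bi ci)))
                         (is01-⟦⟧ (lookup y j) (trans (coord eq j) (at-11 (lookup a j) bj cj))) eq
  where
  open ℚSolver.+-*-Solver using (solve; con; _:+_; _:*_; _:=_)
  at-10 : ∀ x {y z} → y ≡ true → z ≡ false → val 0ℚ β γ x y z ≡ β
  at-10 x refl refl = solve 3 (λ x β γ → con 0ℚ :* x :+ (β :* con 1ℚ :+ (γ :* con 0ℚ :+ con 0ℚ)) := β) refl ⟦ x ⟧ β γ
  at-11 : ∀ x {y z} → y ≡ true → z ≡ true → val 0ℚ β γ x y z ≡ γ ℚ.+ β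
  at-11 x refl refl = solve 3 (λ x β γ → con 0ℚ :* x :+ (β :* con 1ℚ :+ (γ :* con 1ℚ :+ con 0ℚ)) := γ :+ β) refl ⟦ x ⟧ β γ
  -- A point of `b` outside `c` shows the value β, a common point shows β + γ. The four possible
  -- combinations 0, c, b - c and b are contained in `b` or in `c`, so none of them is above `b`.
  go : ∀ {β} γ → Is01 β → Is01 (γ ℚ.+ β) → Combines 0ℚ β γ a b c y → ⊥
  go γ (inj₁ refl) (inj₁ s) eq with refl ← cancel γ 0ℚ s =
    ⊆⇒⊁ (letterwise 0ℚ 0ℚ 0ℚ (λ x y z w → w ⇒? y) eq) y≻b
  go γ (inj₁ refl) (inj₂ s) eq with refl ← cancel γ 0ℚ s =
    ⊆⇒⊁ (letterwise 0ℚ 0ℚ 1ℚ (λ x y z w → w ⇒? z) eq) (≻-trans y≻b b≻c)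
  go γ (inj₂ refl) (inj₁ s) eq with refl ← cancel γ 1ℚ s =
    ⊆⇒⊁ (letterwise 0ℚ 1ℚ -1ℚ (λ x y z w → w ⇒? y) eq) y≻b
  go γ (inj₂ refl) (inj₂ s) eq with refl ← cancel γ 1ℚ s =
    ⊆⇒⊁ (letterwise 0ℚ 1ℚ 0ℚ (λ x y z w → w ⇒? y) eq) y≻b

module TripleCombination {n} {a b c y : Subset n}
  (y≻a : y ≻ a) (a≻b : a ≻ b) (b≻c : b ≻ c)
  (a∩b : Meet a b) (a∩c : Meet a c) (b∩c : Meet b c)
  (¬between : ∃ λ i → between (lookup a i) (lookup b i) (lookup c i) ≡ false)
  (¬evenly : ∃ λ i → evenly (lookup a i) (lookup b i) (lookup c i) ≡ false)
  where

  private
    y≻b = ≻-trans y≻a a≻b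

  module _ (α β γ : ℚ) (eq : Combines α β γ a b c y) where

    α≢0 : α ≢ 0ℚ
    α≢0 refl = pair-combination β γ y≻b b≻c b∩c eq

    β≢0 : β ≢ 0ℚ
    β≢0 refl = pair-combination α γ {b} y≻a (≻-trans a≻b b≻c) a∩c (combines λ i →
      trans (coord eq i) (swap ⟦ lookup a i ⟧ ⟦ lookup b i ⟧ ⟦ lookup c i ⟧))
      where
      open ℚSolver.+-*-Solver using (solve; con; _:+_; _:*_; _:=_)
      swap : ∀ p q r → α ℚ.* p ℚ.+ (0ℚ ℚ.* q ℚ.+ (γ ℚ.* r ℚ.+ 0ℚ)) ≡ 0ℚ ℚ.* q ℚ.+ (α ℚ.* p ℚ.+ (γ ℚ.* r ℚ.+ 0ℚ))
      swap = solve 5 (λ α γ p q r → α :* p :+ (con 0ℚ :* q :+ (γ :* r :+ con 0ℚ)) :=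
                                    con 0ℚ :* q :+ (α :* p :+ (γ :* r :+ con 0ℚ))) refl α γ

    γ≢0 : γ ≢ 0ℚ
    γ≢0 refl = pair-combination α β {c} y≻a a≻b a∩b (combines λ i →
      trans (coord eq i) (rotate ⟦ lookup a i ⟧ ⟦ lookup b i ⟧ ⟦ lookup c i ⟧))
      where
      open ℚSolver.+-*-Solver using (solve; con; _:+_; _:*_; _:=_)
      rotate : ∀ p q r → α ℚ.* p ℚ.+ (β ℚ.* q ℚ.+ (0ℚ ℚ.* r ℚ.+ 0ℚ)) ≡ 0ℚ ℚ.* r ℚ.+ (α ℚ.* p ℚ.+ (β ℚ.* q ℚ.+ 0ℚ))
      rotate = solve 5 (λ α β p q r → α :* p :+ (β :* q :+ (con 0ℚ :* r :+ con 0ℚ)) :=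
                                      con 0ℚ :* r :+ (α :* p :+ (β :* q :+ con 0ℚ))) refl α β

    letter : ∀ i {x y z q} → lookup a i ≡ x → lookup b i ≡ y → lookup c i ≡ z → val α β γ x y z ≡ q → Is01 q
    letter i refl refl refl e = is01-⟦⟧ (lookup y i) (trans (coord eq i) e)

    is01-comm : ∀ p q → Is01 (p ℚ.+ q) → Is01 (q ℚ.+ p)
    is01-comm p q = subst Is01 (ℚ.+-comm p q)

    -- The pairwise intersections now consist of points in exactly two sets, which bounds the three
    -- sums of two coefficients. `evenly` fails where an odd number of sets meet; three is excluded,
    -- so some point lies in one set only and `no-private` applies.
    no-triple-point : (∀ i → not (lookup a i ∧ lookup b i ∧ lookup c i) ≡ true) → ⊥
    no-triple-point h = go a∩b a∩c b∩c ¬evenly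
      where
      go : Meet a b → Meet a c → Meet b c → (∃ λ i → evenly (lookup a i) (lookup b i) (lookup c i) ≡ false) → ⊥
      go (i , ai , bi) (j , aj , cj) (k , bk , ck) (l , el) = private-point l refl refl refl el
        where
        third : ∀ {z} → not z ≡ true → z ≡ false
        third {false} _ = refl
        at-i : not (true ∧ true ∧ lookup c i) ≡ true
        at-i = subst₂ (λ p q → not (p ∧ q ∧ lookup c i) ≡ true) ai bi (h i)
        at-j : ∀ {x y z} → x ≡ true → z ≡ true → not (x ∧ y ∧ z) ≡ true → y ≡ false
        at-j {y = false} refl refl _ = refl
        at-k : ∀ {x y z} → y ≡ true → z ≡ true → not (x ∧ y ∧ z) ≡ true → x ≡ false
        at-k {x = false} refl refl _ = refl
        αβ = letter i ai bi (third at-i) (val-110 α β γ)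
        αγ = letter j aj (at-j {lookup a j} aj cj (h j)) cj (val-101 α β γ)
        βγ = letter k (at-k {lookup a k} bk ck (h k)) bk ck (val-011 α β γ)
        private-point : ∀ l {x y z} → lookup a l ≡ x → lookup b l ≡ y → lookup c l ≡ z → evenly x y z ≡ false → ⊥
        private-point l {true}  {true}  {true}  p q r _ with subst₂ (λ s t → not (s ∧ t) ≡ true) p (cong₂ _∧_ q r) (h l)
        ... | ()
        private-point l {true}  {false} {false} p q r _ = no-private α≢0 β≢0 γ≢0
          (letter l p q r (val-100 α β γ)) (is01-comm α β αβ) (is01-comm α γ αγ) βγ
        private-point l {false} {true}  {false} p q r _ = no-private β≢0 α≢0 γ≢0
          (letter l p q r (val-010 α β γ)) αβ (is01-comm β γ βγ) αγ
        private-point l {false} {false} {true}  p q r _ = no-private γ≢0 α≢0 β≢0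
          (letter l p q r (val-001 α β γ)) αγ βγ αβ
        private-point l {true}  {true}  {false} p q r ()
        private-point l {true}  {false} {true}  p q r ()
        private-point l {false} {true}  {true}  p q r ()
        private-point l {false} {false} {false} p q r ()

  bal? : ∀ p q r s → Dec (bit p ℕ.+ bit q ≡ bit r ℕ.+ bit s)
  bal? p q r s = bit p ℕ.+ bit q ℕ.≟ bit r ℕ.+ bit s

  -- Here y - b = c - a, so y ≻ b would put `c` above `a`.
  b+c : ¬ Combines -1ℚ 1ℚ 1ℚ a b c y
  b+c eq = ≻-asym (≻-trans a≻b b≻c) (≻-shift (letterwise -1ℚ 1ℚ 1ℚ (λ x y z w → bal? z y x w) eq) y≻b)

  a+c : ¬ Combines 1ℚ -1ℚ 1ℚ a b c y
  a+c eq = ≻-asym b≻c (≻-shift (letterwise 1ℚ -1ℚ 1ℚ (λ x y z w → bal? z x y w) eq) y≻a)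

  a+b : ¬ Combines 1ℚ 1ℚ -1ℚ a b c y
  a+b eq with () ← trans (sym (proj₂ ¬between))
    (letterwise 1ℚ 1ℚ -1ℚ (λ x y z w → between x y z 𝔹.≟ true) eq (proj₁ ¬between))

  -- The sum of all three coefficients is 0 or 1, which determines α. The value -2 would put `a`
  -- inside `b`, the values 2 and 3 would put `y` inside `a`, each against the order. Otherwise α is
  -- 0 or the coefficients are two 1s and one -1, as excluded above.
  units-βγ : ∀ α {β γ} → IsUnit β → IsUnit γ → Is01 (α ℚ.+ (β ℚ.+ γ)) → α ≢ 0ℚ → ¬ Combines α β γ a b c y
  units-βγ α (inj₁ refl) (inj₁ refl) (inj₁ s) α≢0 eq with refl ← cancel α 2ℚ s =
    ⊆⇒⊁ (letterwise -2ℚ 1ℚ 1ℚ (λ x y z w → x ⇒? y) eq) a≻b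
  units-βγ α (inj₁ refl) (inj₁ refl) (inj₂ s) α≢0 eq with refl ← cancel α 2ℚ s = b+c eq
  units-βγ α (inj₁ refl) (inj₂ refl) (inj₁ s) α≢0 eq = α≢0 (cancel α 0ℚ s)
  units-βγ α (inj₁ refl) (inj₂ refl) (inj₂ s) α≢0 eq with refl ← cancel α 0ℚ s = a+b eq
  units-βγ α (inj₂ refl) (inj₁ refl) (inj₁ s) α≢0 eq = α≢0 (cancel α 0ℚ s)
  units-βγ α (inj₂ refl) (inj₁ refl) (inj₂ s) α≢0 eq with refl ← cancel α 0ℚ s = a+c eq
  units-βγ α (inj₂ refl) (inj₂ refl) (inj₁ s) α≢0 eq with refl ← cancel α -2ℚ s =
    ⊆⇒⊁ (letterwise 2ℚ -1ℚ -1ℚ (λ x y z w → w ⇒? x) eq) y≻a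
  units-βγ α (inj₂ refl) (inj₂ refl) (inj₂ s) α≢0 eq with refl ← cancel α -2ℚ s =
    ⊆⇒⊁ (letterwise 3ℚ -1ℚ -1ℚ (λ x y z w → w ⇒? x) eq) y≻a

  units-αγ : ∀ {α} β {γ} → IsUnit α → IsUnit γ → Is01 (β ℚ.+ (α ℚ.+ γ)) → β ≢ 0ℚ → ¬ Combines α β γ a b c y
  units-αγ β (inj₁ refl) (inj₁ refl) (inj₁ s) β≢0 eq with refl ← cancel β 2ℚ s =
    ⊆⇒⊁ (letterwise 1ℚ -2ℚ 1ℚ (λ x y z w → y ⇒? z) eq) b≻c
  units-αγ β (inj₁ refl) (inj₁ refl) (inj₂ s) β≢0 eq with refl ← cancel β 2ℚ s = a+c eq
  units-αγ β (inj₁ refl) (inj₂ refl) (inj₁ s) β≢0 eq = β≢0 (cancel β 0ℚ s)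
  units-αγ β (inj₁ refl) (inj₂ refl) (inj₂ s) β≢0 eq with refl ← cancel β 0ℚ s = a+b eq
  units-αγ β (inj₂ refl) (inj₁ refl) (inj₁ s) β≢0 eq = β≢0 (cancel β 0ℚ s)
  units-αγ β (inj₂ refl) (inj₁ refl) (inj₂ s) β≢0 eq with refl ← cancel β 0ℚ s = b+c eq
  units-αγ β (inj₂ refl) (inj₂ refl) (inj₁ s) β≢0 eq with refl ← cancel β -2ℚ s =
    ⊆⇒⊁ (letterwise -1ℚ 2ℚ -1ℚ (λ x y z w → w ⇒? y) eq) y≻b
  units-αγ β (inj₂ refl) (inj₂ refl) (inj₂ s) β≢0 eq with refl ← cancel β -2ℚ s =
    ⊆⇒⊁ (letterwise -1ℚ 3ℚ -1ℚ (λ x y z w → w ⇒? y) eq) y≻b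

  module _ (α β γ : ℚ) (eq : Combines α β γ a b c y) (j : Fin n)
    (aj : lookup a j ≡ true) (bj : lookup b j ≡ true) (cj : lookup c j ≡ true) where

    private
      at = letter α β γ eq
      total : Is01 (α ℚ.+ β ℚ.+ γ)
      total = at j aj bj cj (val-111 α β γ)
      total-α : Is01 (α ℚ.+ (β ℚ.+ γ))
      total-α = subst Is01 (ℚ.+-assoc α β γ) total
      total-β : Is01 (β ℚ.+ (α ℚ.+ γ))
      total-β = subst Is01 (trans (cong (ℚ._+ γ) (ℚ.+-comm α β)) (ℚ.+-assoc β α γ)) total
      total-γ : Is01 (γ ℚ.+ (α ℚ.+ β))
      total-γ = subst Is01 (ℚ.+-comm (α ℚ.+ β) γ) total

    -- `between` fails at a point of a ∩ b outside `c` or at a point of `c` alone. The former gives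
    -- γ as the total minus α + β, the latter gives γ directly.
    unit-γ : ∀ i {x y z} → lookup a i ≡ x → lookup b i ≡ y → lookup c i ≡ z → between x y z ≡ false → IsUnit γ
    unit-γ i {true}  {true}  {false} p q r _ =
      unit-diff γ (α ℚ.+ β) total-γ (at i p q r (val-110 α β γ)) (γ≢0 α β γ eq)
    unit-γ i {false} {false} {true}  p q r _ = inj₁ (nonzero-01 (at i p q r (val-001 α β γ)) (γ≢0 α β γ eq))
    unit-γ i {true}  {true}  {true}  p q r ()
    unit-γ i {true}  {false}         p q r ()
    unit-γ i {false} {true}          p q r ()
    unit-γ i {false} {false} {false} p q r ()

    -- A point of `a` outside `b` shows either α or α + γ. The former makes α a unit; the latter,
    -- compared with the total, makes β a unit. Either way the total fixes the remaining
    -- coefficient.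
    triple-point : IsUnit γ → (∃ λ i → lookup a i ≡ true × lookup b i ≡ false) → ⊥
    triple-point uγ (i , p , q) with lookup c i in r
    ... | false = units-αγ β (inj₁ (nonzero-01 (at i p q r (val-100 α β γ)) (α≢0 α β γ eq))) uγ total-β (β≢0 α β γ eq) eq
    ... | true  = units-βγ α (unit-diff β (α ℚ.+ γ) total-β (at i p q r (val-101 α β γ)) (β≢0 α β γ eq))
                    uγ total-α (α≢0 α β γ eq) eq

  triple-combination : ∀ α β γ → ¬ Combines α β γ a b c y
  triple-combination α β γ eq with all₃ (λ x y z → not (x ∧ y ∧ z)) a b c in e
  ... | true  = no-triple-point α β γ eq (all₃-true _ a b c e)
  ... | false with all₃-false _ a b c e
  ...   | j , ej = let aj , bj , cj = all-true ej in
    triple-point α β γ eq j aj bj cj (unit-γ α β γ eq j aj bj cj (proj₁ ¬between) refl refl refl (proj₂ ¬between)) (≻-witness a≻b)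
    where
    all-true : ∀ {x y z} → not (x ∧ y ∧ z) ≡ false → x ≡ true × y ≡ true × z ≡ true
    all-true {true} {true} {true} _ = refl , refl , refl

-- The ground list in decreasing order and its broken circuits

descending : ∀ n → List (Subset n)
descending zero    = [] ∷ []
descending (suc n) = map (true ∷_) (descending n) ++ map (false ∷_) (descending n)

ground : ∀ n → List (Subset n)
ground n = filter (λ I → isNonempty I 𝔹.≟ true) (descending n)

resonance-↭ : ∀ n → resonance n ↭ ground n
resonance-↭ n = ↭.filter-↭ _ (reorder n)
  where
  reorder : ∀ n → allSubsets n ↭ descending n
  reorder zero    = ↭-refl
  reorder (suc n) = ↭-trans (↭.++-comm (map (false ∷_) (allSubsets n)) _) (↭.++⁺ (↭.map⁺ _ (reorder n)) (↭.map⁺ _ (reorder n)))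

ground-sorted : ∀ n → AllPairs _≻_ (ground n)
ground-sorted n = AllPairs.filter⁺ _ (sorted n)
  where
  sorted : ∀ n → AllPairs _≻_ (descending n)
  sorted zero    = [] ∷ []
  sorted (suc n) = AllPairs.++⁺ (AllPairs.map⁺ (AllPairs.map next (sorted n))) (AllPairs.map⁺ (AllPairs.map next (sorted n)))
    (All.map⁺ (All.universal (λ _ → All.map⁺ (All.universal (λ _ → top) (descending n))) (descending n)))

∈-descending : ∀ {n} (a : Subset n) → a ∈ descending n
∈-descending []          = here refl
∈-descending (true ∷ a)  = ∈-++⁺ˡ (∈-map⁺ _ (∈-descending a))
∈-descending (false ∷ a) = ∈-++⁺ʳ (map (true ∷_) (descending _)) (∈-map⁺ _ (∈-descending a))

Nonempty : ∀ {n} → Subset n → Set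
Nonempty a = ∃ λ i → lookup a i ≡ true

isNonempty⁺ : ∀ {n} (a : Subset n) → Nonempty a → isNonempty a ≡ true
isNonempty⁺ (true  ∷ a) _           = refl
isNonempty⁺ (false ∷ a) (suc i , p) = isNonempty⁺ a (i , p)

isNonempty⁻ : ∀ {n} (a : Subset n) → isNonempty a ≡ true → Nonempty a
isNonempty⁻ (true  ∷ a) _ = zero , refl
isNonempty⁻ (false ∷ a) p with isNonempty⁻ a p
... | i , q = suc i , q

∈-ground⁺ : ∀ {n} {a : Subset n} → Nonempty a → a ∈ ground n
∈-ground⁺ {a = a} ne = ∈-filter⁺ _ (∈-descending a) (isNonempty⁺ a ne)

∈-ground⁻ : ∀ {n} {a : Subset n} → a ∈ ground n → Nonempty a
∈-ground⁻ {n} {a} a∈ = isNonempty⁻ a (proj₂ (∈-filter⁻ (λ I → isNonempty I 𝔹.≟ true) {xs = descending n} a∈))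

≻-∈-ground : ∀ {n} {a b : Subset n} → a ≻ b → a ∈ ground n
≻-∈-ground a≻b with ≻-witness a≻b
... | i , p , _ = ∈-ground⁺ (i , p)

linComb-avoids : ∀ {n} c (S : List (Subset n)) {i} → All (λ s → lookup s i ≡ false) S → linComb c (map normal S) i ≡ 0ℚ
linComb-avoids []      S       _        = refl
linComb-avoids (x ∷ c) []      _        = refl
linComb-avoids (x ∷ c) (s ∷ S) {i} (p ∷ ps) rewrite p | linComb-avoids c S ps =
  trans (ℚ.+-identityʳ _) (ℚ.*-zeroʳ x)

cl-avoids : ∀ {n S} {y : Subset n} i → lookup y i ≡ true → All (λ s → lookup s i ≡ false) S → ¬ Cl S y
cl-avoids {S = S} {y} i p ps cy = ¬¬-span cy λ { (c , e) → contra (trans (sym (cong ⟦_⟧ p)) (trans (e i) (linComb-avoids c S ps))) }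
  where
  contra : ¬ 1ℚ ≡ 0ℚ
  contra ()

cl-pair : ∀ {n} {b c y : Subset n} → y ≻ b → b ≻ c → Meet b c → ¬ Cl (b ∷ c ∷ []) y
cl-pair {b = b} {c} {y} y≻b b≻c m cy = ¬¬-span cy λ { (k , e) → go k e }
  where
  open ℚSolver.+-*-Solver using (solve; con; _:+_; _:*_; _:=_)
  finish : ∀ β γ → (∀ i → ⟦ lookup y i ⟧ ≡ linComb (β ∷ γ ∷ []) (map normal (b ∷ c ∷ [])) i) → ⊥
  finish β γ e = pair-combination β γ {b} y≻b b≻c m (combines λ i → trans (e i)
    (solve 2 (λ x t → t := con 0ℚ :* x :+ t) refl ⟦ lookup b i ⟧ (linComb (β ∷ γ ∷ []) (map normal (b ∷ c ∷ [])) i)))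
  go : ∀ k → (∀ i → ⟦ lookup y i ⟧ ≡ linComb k (map normal (b ∷ c ∷ [])) i) → ⊥
  go []          e = finish 0ℚ 0ℚ λ i → trans (e i) (sym (linComb-fit [] (map normal (b ∷ c ∷ [])) i))
  go (β ∷ [])    e = finish β 0ℚ λ i → trans (e i) (sym (linComb-fit (β ∷ []) (map normal (b ∷ c ∷ [])) i))
  go (β ∷ γ ∷ k) e = finish β γ λ i → trans (e i) (sym (linComb-fit (β ∷ γ ∷ k) (map normal (b ∷ c ∷ [])) i))

cl-triple : ∀ {n} {a b c y : Subset n} → (∀ α β γ → ¬ Combines α β γ a b c y) → ¬ Cl (a ∷ b ∷ c ∷ []) y
cl-triple {a = a} {b} {c} {y} none cy = ¬¬-span cy λ { (k , e) → go k e }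
  where
  vs = map normal (a ∷ b ∷ c ∷ [])
  go : ∀ k → (∀ i → ⟦ lookup y i ⟧ ≡ linComb k vs i) → ⊥
  go []              e = none 0ℚ 0ℚ 0ℚ (combines λ i → trans (e i) (sym (linComb-fit [] vs i)))
  go (α ∷ [])        e = none α 0ℚ 0ℚ (combines λ i → trans (e i) (sym (linComb-fit (α ∷ []) vs i)))
  go (α ∷ β ∷ [])    e = none α β 0ℚ (combines λ i → trans (e i) (sym (linComb-fit (α ∷ β ∷ []) vs i)))
  go (α ∷ β ∷ γ ∷ k) e = none α β γ (combines λ i → trans (e i) (sym (linComb-fit (α ∷ β ∷ γ ∷ k) vs i)))

avoids : ∀ {n} → Subset n → Subset n → Subset n → Bool
avoids a b c = not (disjoint a b) ∧ not (disjoint a c) ∧ not (disjoint b c) ∧ not (all₃ between a b c) ∧ not (all₃ evenly a b c)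

not-true : ∀ {x} → not x ≡ true → x ≡ false
not-true {false} _ = refl

≢true : ∀ {x} → (x ≡ true → ⊥) → x ≡ false
≢true {false} _ = refl
≢true {true}  h = contradiction refl h

-- Disjoint nonempty sets form a circuit with their union; the union is above `a`, so it is the
-- element whose removal breaks the circuit.
union-≻ : ∀ {n} (a b : Subset n) → Nonempty b → (∀ i → not (lookup a i ∧ lookup b i) ≡ true) →
  ∃ λ y → y ≻ a × (∀ i → lookup y i ≡ lookup a i ∨ lookup b i)
union-≻ a b (j , bj) h = tabulate (λ i → lookup a i ∨ lookup b i) ,
  ⊋⇒≻ (λ i ai → trans (at i) (left ai))
    (j , trans (at j) (trans (cong (lookup a j ∨_) bj) (right (lookup a j))) , other {lookup a j} bj (h j)) , at
  where
  at = lookup∘tabulate (λ i → lookup a i ∨ lookup b i)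
  left : ∀ {x y} → x ≡ true → x ∨ y ≡ true
  left refl = refl
  right : ∀ x → x ∨ true ≡ true
  right true  = refl
  right false = refl
  other : ∀ {x y} → y ≡ true → not (x ∧ y) ≡ true → x ≡ false
  other {false} refl _ = refl

⟦∨⟧ : ∀ x y → not (x ∧ y) ≡ true → ⟦ x ∨ y ⟧ ≡ 1ℚ ℚ.* ⟦ x ⟧ ℚ.+ (1ℚ ℚ.* ⟦ y ⟧ ℚ.+ 0ℚ)
⟦∨⟧ true  false _ = refl
⟦∨⟧ false true  _ = refl
⟦∨⟧ false false _ = refl

-- `a` and `c` alone are not a tail of the triple, so their union is exhibited in the span of all
-- three sets, with coefficient 0 on the middle one.
⟦∨⟧₃ : ∀ x y z → not (x ∧ z) ≡ true → ⟦ x ∨ z ⟧ ≡ val 1ℚ 0ℚ 1ℚ x y z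
⟦∨⟧₃ true  true  false _ = refl
⟦∨⟧₃ true  false false _ = refl
⟦∨⟧₃ false true  true  _ = refl
⟦∨⟧₃ false false true  _ = refl
⟦∨⟧₃ false true  false _ = refl
⟦∨⟧₃ false false false _ = refl

cl-intro : ∀ {n S} {y : Subset n} k → (∀ i → ⟦ lookup y i ⟧ ≡ linComb k (map normal S) i) → Cl S y
cl-intro k e = closure λ ns → ns (k , e)

module _ {n} {a b c : Subset n} where

  -- The set is a + b - c. It is above `a` because y - a = b - c.
  between-≻ : b ≻ c → (∀ i → between (lookup a i) (lookup b i) (lookup c i) ≡ true) →
    ∃ λ y → y ≻ a × Cl (a ∷ b ∷ c ∷ []) y
  between-≻ b≻c h = tabulate _ ,
    ≻-shift (λ i → trans (cong (λ t → bit t ℕ.+ bit (lookup c i)) (at i)) (balance (lookup a i) (lookup b i) (lookup c i) (h i))) b≻c ,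
    cl-intro (1ℚ ∷ 1ℚ ∷ -1ℚ ∷ []) λ i → trans (cong ⟦_⟧ (at i)) (value (lookup a i) (lookup b i) (lookup c i) (h i))
    where
    f : Bool → Bool → Bool → Bool
    f x y z = (x ∧ y) ∨ ((x ∨ y) ∧ not z)
    at = lookup∘tabulate (λ i → f (lookup a i) (lookup b i) (lookup c i))
    balance : ∀ x y z → between x y z ≡ true → bit (f x y z) ℕ.+ bit z ≡ bit x ℕ.+ bit y
    balance true  true  true  _ = refl
    balance true  false true  _ = refl
    balance true  false false _ = refl
    balance false true  true  _ = refl
    balance false true  false _ = refl
    balance false false false _ = refl
    value : ∀ x y z → between x y z ≡ true → ⟦ f x y z ⟧ ≡ val 1ℚ 1ℚ -1ℚ x y z
    value true  true  true  _ = refl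
    value true  false true  _ = refl
    value true  false false _ = refl
    value false true  true  _ = refl
    value false true  false _ = refl
    value false false false _ = refl

  -- If every point lies in none or in two of the sets, (a + b + c)/2 is their union. It contains
  -- `a` strictly, since a common point of `b` and `c` cannot lie in `a` too.
  evenly-≻ : Meet b c → (∀ i → evenly (lookup a i) (lookup b i) (lookup c i) ≡ true) →
    ∃ λ y → y ≻ a × Cl (a ∷ b ∷ c ∷ []) y
  evenly-≻ (j , bj , cj) h = tabulate _ ,
    ⊋⇒≻ (λ i ai → trans (at i) (cong (_∨ (lookup b i ∨ lookup c i)) ai))
      (j , trans (at j) (covered (lookup a j) bj) , third bj cj (h j)) ,
    cl-intro (½ ∷ ½ ∷ ½ ∷ []) λ i → trans (cong ⟦_⟧ (at i)) (value (lookup a i) (lookup b i) (lookup c i) (h i))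
    where
    at = lookup∘tabulate (λ i → lookup a i ∨ (lookup b i ∨ lookup c i))
    covered : ∀ x {y z} → y ≡ true → x ∨ (y ∨ z) ≡ true
    covered true  refl = refl
    covered false refl = refl
    third : ∀ {x y z} → y ≡ true → z ≡ true → evenly x y z ≡ true → x ≡ false
    third {false} refl refl _ = refl
    value : ∀ x y z → evenly x y z ≡ true → ⟦ x ∨ (y ∨ z) ⟧ ≡ val ½ ½ ½ x y z
    value true  true  false _ = refl
    value true  false true  _ = refl
    value false true  true  _ = refl
    value false false false _ = refl

module Circuits {n : ℕ} (cl? : ∀ S x → Dec (Cl {n} S x)) where
  open Whitney Cl cl-stable cl-∈ cl-trans cl-exchange cl?

  NoBrokenCircuit : List (Subset n) → Set
  NoBrokenCircuit = NBC _≻_ _≻?_ ≻-asym (ground n)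

  nbc-singleton : ∀ c → NoBrokenCircuit (c ∷ [])
  nbc-singleton c = All.tabulate (λ {y} _ y≻c → let i , p , q = ≻-witness y≻c in cl-avoids {y = y} i p (q ∷ [])) ,
    All.tabulate λ {y} y∈ → let i , p = ∈-ground⁻ y∈ in cl-avoids {y = y} i p []

  nbc-pair⁺ : ∀ {b c} → b ≻ c → Meet b c → NoBrokenCircuit (b ∷ c ∷ [])
  nbc-pair⁺ {c = c} b≻c m = All.tabulate (λ _ y≻b → cl-pair y≻b b≻c m) , nbc-singleton c

  nbc-pair⁻ : ∀ {b c} → Nonempty c → NoBrokenCircuit (b ∷ c ∷ []) → disjoint b c ≡ false
  nbc-pair⁻ {b} {c} ne (h , _) = ≢true λ d →
    let y , y≻b , at = union-≻ b c ne (disjoint-true b c d)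
    in All.lookup h (≻-∈-ground y≻b) y≻b
      (cl-intro (1ℚ ∷ 1ℚ ∷ []) λ i → trans (cong ⟦_⟧ (at i)) (⟦∨⟧ (lookup b i) (lookup c i) (disjoint-true b c d i)))

  nbc-triple⁺ : ∀ {a b c} → a ≻ b → b ≻ c → avoids a b c ≡ true → NoBrokenCircuit (a ∷ b ∷ c ∷ [])
  nbc-triple⁺ {a} {b} {c} a≻b b≻c h =
    let ab , h₁ = ∧-true {not (disjoint a b)} h
        ac , h₂ = ∧-true {not (disjoint a c)} h₁
        bc , h₃ = ∧-true {not (disjoint b c)} h₂
        bt , ev = ∧-true {not (all₃ between a b c)} h₃
        meet = λ a b (d : not (disjoint a b) ≡ true) → disjoint-false a b (not-true d)
    in All.tabulate (λ _ y≻a → cl-triple (TripleCombination.triple-combination y≻a a≻b b≻c (meet a b ab) (meet a c ac) (meet b c bc)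
         (all₃-false between a b c (not-true bt)) (all₃-false evenly a b c (not-true ev)))) ,
       nbc-pair⁺ b≻c (meet b c bc)

  nbc-triple⁻ : ∀ {a b c} → Nonempty b → Nonempty c → b ≻ c → NoBrokenCircuit (a ∷ b ∷ c ∷ []) → avoids a b c ≡ true
  nbc-triple⁻ {a} {b} {c} nb nc b≻c (h , h′) = none ab ac (nbc-pair⁻ nc h′) bt ev
    where
    none : ∀ {p q r s t} → p ≡ false → q ≡ false → r ≡ false → s ≡ false → t ≡ false →
      not p ∧ not q ∧ not r ∧ not s ∧ not t ≡ true
    none refl refl refl refl refl = refl
    forbidden : (∃ λ y → y ≻ a × Cl (a ∷ b ∷ c ∷ []) y) → ⊥
    forbidden (y , y≻a , cy) = All.lookup h (≻-∈-ground y≻a) y≻a cy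
    ab : disjoint a b ≡ false
    ab = ≢true λ d → let y , y≻a , at = union-≻ a b nb (disjoint-true a b d) in forbidden (y , y≻a ,
      cl-intro (1ℚ ∷ 1ℚ ∷ []) λ i → trans (cong ⟦_⟧ (at i)) (⟦∨⟧ (lookup a i) (lookup b i) (disjoint-true a b d i)))
    ac : disjoint a c ≡ false
    ac = ≢true λ d → let y , y≻a , at = union-≻ a c nc (disjoint-true a c d) in forbidden (y , y≻a ,
      cl-intro (1ℚ ∷ 0ℚ ∷ 1ℚ ∷ []) λ i → trans (cong ⟦_⟧ (at i))
        (⟦∨⟧₃ (lookup a i) (lookup b i) (lookup c i) (disjoint-true a c d i)))
    bt : all₃ between a b c ≡ false
    bt = ≢true λ e → forbidden (between-≻ b≻c (all₃-true between a b c e))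
    ev : all₃ evenly a b c ≡ false
    ev = ≢true λ e → forbidden (evenly-≻ (disjoint-false b c (nbc-pair⁻ nc h′)) (all₃-true evenly a b c e))

-- Counting by transfer operators

∑-swap : ∀ {A B : Set} (xs : List A) (ys : List B) (f : A → B → ℤ) →
  ∑ xs (λ x → ∑ ys (f x)) ≡ ∑ ys (λ y → ∑ xs (λ x → f x y))
∑-swap []       ys f = sym (∑-0 ys)
∑-swap (x ∷ xs) ys f = trans (cong (λ z → ∑ ys (f x) ℤ.+ z) (∑-swap xs ys f)) (sym (∑-+ ys (f x) _))

∑-concatMap : ∀ {A B : Set} (h : A → List B) xs (f : B → ℤ) → ∑ (concatMap h xs) f ≡ ∑ xs (λ x → ∑ (h x) f)
∑-concatMap h []       f = refl
∑-concatMap h (x ∷ xs) f = trans (∑-++ (h x) f) (cong (λ z → ∑ (h x) f ℤ.+ z) (∑-concatMap h xs f))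

∑-replicate : ∀ {A : Set} m (x : A) (f : A → ℤ) → ∑ (List.replicate m x) f ≡ + m ℤ.* f x
∑-replicate zero    x f = refl
∑-replicate (suc m) x f = trans (cong (λ z → f x ℤ.+ z) (∑-replicate m x f)) (lemma (f x) (+ m))
  where
  lemma : ∀ y k → y ℤ.+ k ℤ.* y ≡ (1ℤ ℤ.+ k) ℤ.* y
  lemma = solve-∀

evaluate : ℕ → List (ℕ × ℤ) → ℤ
evaluate n cs = ∑ cs λ (k , c) → c ℤ.* + (k ℕ.^ n)

-- Counting walks of length n in a finite digraph whose transition operator is diagonalisable
-- with eigenvalues 1, …, 8 on the acceptance vector. The eigencomponents are obtained by Lagrange interpolation:
-- the component for k is wₖ ∏_{j≠k} (M − j) applied to acc, scaled by 7! = 5040, with wₖ = (−1)^{8−k} C(7,k−1).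
module Walks {State Table : Set} (tabulate : (State → ℤ) → Table) (look : Table → State → ℤ)
  (all-states? : ∀ {P : State → Set} → (∀ s → Dec (P s)) → Dec (∀ s → P s))
  (successors : State → List State) (acc : State → ℤ) where

  transition : (State → ℤ) → State → ℤ
  transition f s = ∑ (successors s) f

  walks : ℕ → State → ℤ
  walks zero    = acc
  walks (suc n) = transition (walks n)

  Component : Set
  Component = ℕ × ℤ × Table

  component : ℕ × ℤ → Component
  component (k , w) = k , w , foldr
    -- Each factor is tabulated at once: the next one reads stored values instead of unfolding a
    -- tree of successors.
    (λ j T → if j ℕ.≡ᵇ k then T else tabulate (λ s → transition (look T) s ℤ.- + j ℤ.* look T s))
    (tabulate acc) (1 ∷ 2 ∷ 3 ∷ 4 ∷ 5 ∷ 6 ∷ 7 ∷ 8 ∷ [])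

  components : List Component
  components = map component
    -- The product of k - j over all j ≠ k is (-1)^(8-k) (k-1)! (8-k)!, and 7! divided by it is the
    -- weight.
    ((1 , -[1+ 0 ]) ∷ (2 , + 7) ∷ (3 , -[1+ 20 ]) ∷ (4 , + 35) ∷ (5 , -[1+ 34 ]) ∷ (6 , + 21) ∷ (7 , -[1+ 6 ]) ∷ (8 , + 1) ∷ [])

  Eigen : Component → Set
  Eigen (k , w , T) = ∀ s → transition (look T) s ≡ + k ℤ.* look T s

  eigen? : ∀ c → Dec (Eigen c)
  eigen? (k , w , T) = all-states? λ s → transition (look T) s ℤ.≟ + k ℤ.* look T s

  term : State → Component → ℤ
  term s (k , w , T) = w ℤ.* look T s

  Decomposition : List Component → Set
  Decomposition cs = All Eigen cs × (∀ s → + 5040 ℤ.* acc s ≡ ∑ cs (term s))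

  decomposition? : ∀ cs → Dec (Decomposition cs)
  decomposition? cs = All.all? eigen? cs ×-dec all-states? λ s → + 5040 ℤ.* acc s ℤ.≟ ∑ cs (term s)

  power : ℕ → Component → ℤ
  power n (k , _) = + (k ℕ.^ n)

  -- One more step of the walk multiplies each component by its eigenvalue, so the decomposition of
  -- the acceptance vector propagates to every length.
  walks-closed : ∀ {cs} → Decomposition cs → ∀ n s → + 5040 ℤ.* walks n s ≡ ∑ cs (λ c → term s c ℤ.* power n c)
  walks-closed {cs} (_ , d) zero s = trans (d s) (∑-cong cs λ {c} _ → sym (ℤ.*-identityʳ (term s c)))
  walks-closed {cs} (es , d) (suc n) s = begin
    + 5040 ℤ.* ∑ (successors s) (walks n)
      ≡⟨ ∑-*ˡ (+ 5040) (successors s) (walks n) ⟨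
    ∑ (successors s) (λ t → + 5040 ℤ.* walks n t)
      ≡⟨ ∑-cong (successors s) (λ {t} _ → walks-closed (es , d) n t) ⟩
    ∑ (successors s) (λ t → ∑ cs (λ c → term t c ℤ.* power n c))
      ≡⟨ ∑-swap (successors s) cs _ ⟩
    ∑ cs (λ c → ∑ (successors s) (λ t → term t c ℤ.* power n c))
      ≡⟨ ∑-cong cs (λ {c} c∈ → step c (All.lookup es c∈)) ⟩
    ∑ cs (λ c → term s c ℤ.* power (suc n) c) ∎
    where
    open ≡-Reasoning
    step : ∀ c → Eigen c → ∑ (successors s) (λ t → term t c ℤ.* power n c) ≡ term s c ℤ.* power (suc n) c
    step (k , w , T) e = begin
      ∑ (successors s) (λ t → w ℤ.* look T t ℤ.* + (k ℕ.^ n))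
        ≡⟨ ∑-cong (successors s) (λ {t} _ → lemma w (look T t) (+ (k ℕ.^ n))) ⟩
      ∑ (successors s) (λ t → w ℤ.* + (k ℕ.^ n) ℤ.* look T t)
        ≡⟨ ∑-*ˡ (w ℤ.* + (k ℕ.^ n)) (successors s) (look T) ⟩
      w ℤ.* + (k ℕ.^ n) ℤ.* transition (look T) s
        ≡⟨ cong (w ℤ.* + (k ℕ.^ n) ℤ.*_) (e s) ⟩
      w ℤ.* + (k ℕ.^ n) ℤ.* (+ k ℤ.* look T s)
        ≡⟨ lemma₂ w (+ (k ℕ.^ n)) (+ k) (look T s) ⟩
      w ℤ.* look T s ℤ.* (+ k ℤ.* + (k ℕ.^ n))
        ≡⟨ cong (w ℤ.* look T s ℤ.*_) (ℤ.pos-* k (k ℕ.^ n)) ⟨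
      w ℤ.* look T s ℤ.* + (k ℕ.^ suc n) ∎
      where
      lemma : ∀ w t p → w ℤ.* t ℤ.* p ≡ w ℤ.* p ℤ.* t
      lemma = solve-∀
      lemma₂ : ∀ w p k t → w ℤ.* p ℤ.* (k ℤ.* t) ≡ w ℤ.* t ℤ.* (k ℤ.* p)
      lemma₂ = solve-∀

  coefficients : State → List (ℕ × ℤ)
  coefficients s = map (λ c → proj₁ c , term s c) components

  walks-formula : Decomposition components → ∀ {s cs} → coefficients s ≡ cs → ∀ n → + 5040 ℤ.* walks n s ≡ evaluate n cs
  walks-formula d {s} refl n = trans (walks-closed d n s)
    (sym (∑-map (λ c → proj₁ c , term s c) components {λ (k , c) → c ℤ.* + (k ℕ.^ n)}))

Tree : ℕ → Set
Tree zero    = ℤ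
Tree (suc m) = Tree m × Tree m

grow : ∀ {m} → (Vec Bool m → ℤ) → Tree m
grow {zero}  f = f []
grow {suc m} f = grow (λ s → f (true ∷ s)) , grow (λ s → f (false ∷ s))

leaf : ∀ {m} → Tree m → Vec Bool m → ℤ
leaf t       []          = t
leaf (t , _) (true ∷ s)  = leaf t s
leaf (_ , t) (false ∷ s) = leaf t s

bits-all? : ∀ {m} {P : Vec Bool m → Set} → (∀ s → Dec (P s)) → Dec (∀ s → P s)
bits-all? {zero}  P? = map′ (λ { p [] → p }) (λ h → h []) (P? [])
bits-all? {suc m} P? = map′ (λ { (p , q) (true ∷ s) → p s ; (p , q) (false ∷ s) → q s })
  (λ h → (h ∘ (true ∷_)) , (h ∘ (false ∷_)))
  (bits-all? (P? ∘ (true ∷_)) ×-dec bits-all? (P? ∘ (false ∷_)))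

𝟙 : Bool → ℤ
𝟙 b = if b then 1ℤ else 0ℤ

bools : List Bool
bools = true ∷ false ∷ []

∑-bits : ∀ n f → ∑ (descending (suc n)) f ≡ ∑ bools (λ x → ∑ (descending n) (λ a → f (x ∷ a)))
∑-bits n f = trans (∑-++ (map (true ∷_) (descending n)) f)
  (cong₂ ℤ._+_ (∑-map (true ∷_) (descending n)) (trans (∑-map (false ∷_) (descending n)) (sym (ℤ.+-identityʳ _))))

-- The flag t records that the two words have agreed so far.
ordered : ∀ {n} → Bool → Subset n → Subset n → Bool
ordered t []      []      = not t
ordered t (x ∷ a) (y ∷ b) = not (t ∧ not x ∧ y) ∧ ordered (t ∧ not (x xor y)) a b

ordered-false : ∀ {n} (a b : Subset n) → ordered false a b ≡ true
ordered-false []      []      = refl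
ordered-false (x ∷ a) (y ∷ b) = ordered-false a b

ordered-true : ∀ {n} (a b : Subset n) → ordered true a b ≡ does (a ≻? b)
ordered-true []          []          = refl
ordered-true (true ∷ a)  (true ∷ b)  = ordered-true a b
ordered-true (true ∷ a)  (false ∷ b) = ordered-false a b
ordered-true (false ∷ a) (true ∷ b)  = refl
ordered-true (false ∷ a) (false ∷ b) = ordered-true a b

choose : ∀ {A : Set} → Bool → A → List A
choose p x = if p then x ∷ [] else []

-- An illegal column has no successor: the legality factor becomes a sum over at most one state.
∑-choose : ∀ {A B : Set} p (t : A) (L : List B) (f : A → B → Bool) →
  ∑ L (λ b → 𝟙 (p ∧ f t b)) ≡ ∑ (choose p t) (λ t → ∑ L (λ b → 𝟙 (f t b)))
∑-choose true  t L f = sym (ℤ.+-identityʳ _)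
∑-choose false t L f = ∑-0 L

module Pairs where
  State = Vec Bool 2

  accepts : ∀ {n} → State → Subset n → Subset n → Bool
  accepts (t ∷ d ∷ []) a b = ordered t a b ∧ not (d ∧ disjoint a b)

  legal : State → Bool → Bool → Bool
  legal (t ∷ d ∷ []) x y = not (t ∧ not x ∧ y)

  step : State → Bool → Bool → State
  step (t ∷ d ∷ []) x y = (t ∧ not (x xor y)) ∷ (d ∧ not (x ∧ y)) ∷ []

  accepts-∷ : ∀ {n} s x y (a b : Subset n) → accepts s (x ∷ a) (y ∷ b) ≡ legal s x y ∧ accepts (step s x y) a b
  accepts-∷ (t ∷ d ∷ []) x y a b rewrite ∧-assoc d (not (x ∧ y)) (disjoint a b) =
    ∧-assoc (not (t ∧ not x ∧ y)) _ _

  move : State → Bool → Bool → List State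
  move s x y = choose (legal s x y) (step s x y)

  successors : State → List State
  successors s = concatMap (λ x → concatMap (move s x) bools) bools

  open Walks grow leaf bits-all? successors (λ s → 𝟙 (accepts s [] [])) public

  total : ℕ → State → ℤ
  total n s = ∑ (descending n) λ a → ∑ (descending n) λ b → 𝟙 (accepts s a b)

  total≡walks : ∀ n s → total n s ≡ walks n s
  total≡walks zero    s = trans (ℤ.+-identityʳ _) (ℤ.+-identityʳ _)
  total≡walks (suc n) s = begin
    total (suc n) s
      ≡⟨ ∑-bits n _ ⟩
    ∑ bools (λ x → ∑ D λ a → ∑ (descending (suc n)) λ b → 𝟙 (accepts s (x ∷ a) b))
      ≡⟨ ∑-cong bools (λ {x} _ → begin
        ∑ D (λ a → ∑ (descending (suc n)) λ b → 𝟙 (accepts s (x ∷ a) b))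
          ≡⟨ ∑-cong D (λ _ → ∑-bits n _) ⟩
        ∑ D (λ a → ∑ bools λ y → ∑ D λ b → 𝟙 (accepts s (x ∷ a) (y ∷ b)))
          ≡⟨ ∑-swap D bools (λ a y → ∑ D λ b → 𝟙 (accepts s (x ∷ a) (y ∷ b))) ⟩
        ∑ bools (λ y → ∑ D λ a → ∑ D λ b → 𝟙 (accepts s (x ∷ a) (y ∷ b)))
          ≡⟨ ∑-cong bools (λ {y} _ → letter x y) ⟩
        ∑ bools (λ y → ∑ (move s x y) (walks n))
          ≡⟨ ∑-concatMap (move s x) bools (walks n) ⟨
        ∑ (concatMap (move s x) bools) (walks n) ∎) ⟩
    ∑ bools (λ x → ∑ (concatMap (move s x) bools) (walks n))
      ≡⟨ ∑-concatMap (λ x → concatMap (move s x) bools) bools (walks n) ⟨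
    walks (suc n) s ∎
    where
    open ≡-Reasoning
    D = descending n
    letter : ∀ x y → ∑ D (λ a → ∑ D λ b → 𝟙 (accepts s (x ∷ a) (y ∷ b))) ≡ ∑ (move s x y) (walks n)
    letter x y = begin
      ∑ D (λ a → ∑ D λ b → 𝟙 (accepts s (x ∷ a) (y ∷ b)))
        ≡⟨ ∑-cong D (λ {a} _ → trans (∑-cong D λ {b} _ → cong 𝟙 (accepts-∷ s x y a b))
             (∑-choose (legal s x y) (step s x y) D (λ t → accepts t a))) ⟩
      ∑ D (λ a → ∑ (move s x y) λ t → ∑ D λ b → 𝟙 (accepts t a b))
        ≡⟨ ∑-swap D (move s x y) (λ a t → ∑ D λ b → 𝟙 (accepts t a b)) ⟩
      ∑ (move s x y) (total n)
        ≡⟨ ∑-cong (move s x y) (λ {t} _ → total≡walks n t) ⟩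
      ∑ (move s x y) (walks n) ∎

  decomposition : Decomposition components
  decomposition = toWitness {a? = decomposition? components} _

  start : State
  start = true ∷ true ∷ []

  -- 5040 times the coefficients 1/2, -1/2, -1/2, 1/2 of 1ⁿ, 2ⁿ, 3ⁿ, 4ⁿ. Two words have only four
  -- columns, so no larger eigenvalue occurs.
  weights : List (ℕ × ℤ)
  weights = (1 , + 2520) ∷ (2 , -[1+ 2519 ]) ∷ (3 , -[1+ 2519 ]) ∷ (4 , + 2520) ∷ (5 , 0ℤ) ∷ (6 , 0ℤ) ∷ (7 , 0ℤ) ∷ (8 , 0ℤ) ∷ []

  formula : ∀ n → + 5040 ℤ.* walks n start ≡ evaluate n weights
  formula = walks-formula decomposition refl

module Triples where
  State = Vec Bool 7

  -- `t` and `u` follow the two order comparisons, `d`, `e`, `f` the three disjointness properties,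
  -- `g` and `h` the two column conditions. A flag stays up while the prefix has not settled the
  -- comparison or refuted the property.
  accepts : ∀ {n} → State → Subset n → Subset n → Subset n → Bool
  accepts (t ∷ u ∷ d ∷ e ∷ f ∷ g ∷ h ∷ []) a b c = ordered t a b ∧ ordered u b c ∧
    not (d ∧ disjoint a b) ∧ not (e ∧ disjoint a c) ∧ not (f ∧ disjoint b c) ∧
    not (g ∧ all₃ between a b c) ∧ not (h ∧ all₃ evenly a b c)

  legal : State → Bool → Bool → Bool → Bool
  legal (t ∷ u ∷ _) x y z = not (t ∧ not x ∧ y) ∧ not (u ∧ not y ∧ z)

  -- Flags only ever fall, so the transition operator is triangular, and its diagonal entry at a
  -- state counts the legal columns that fix it. The zero column always does and there are eight
  -- columns, whence the eigenvalues 1, ..., 8. Triangularity leaves room for Jordan blocks;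
  -- `decomposition` rules out their influence by evaluation at all 128 states.
  step : State → Bool → Bool → Bool → State
  step (t ∷ u ∷ d ∷ e ∷ f ∷ g ∷ h ∷ []) x y z =
    (t ∧ not (x xor y)) ∷ (u ∧ not (y xor z)) ∷
    (d ∧ not (x ∧ y)) ∷ (e ∧ not (x ∧ z)) ∷ (f ∧ not (y ∧ z)) ∷
    (g ∧ between x y z) ∷ (h ∧ evenly x y z) ∷ []

  accepts-∷ : ∀ {n} s x y z (a b c : Subset n) →
    accepts s (x ∷ a) (y ∷ b) (z ∷ c) ≡ legal s x y z ∧ accepts (step s x y z) a b c
  accepts-∷ (t ∷ u ∷ d ∷ e ∷ f ∷ g ∷ h ∷ []) x y z a b c
    rewrite ∧-assoc d (not (x ∧ y)) (disjoint a b)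
          | ∧-assoc e (not (x ∧ z)) (disjoint a c)
          | ∧-assoc f (not (y ∧ z)) (disjoint b c)
          | ∧-assoc g (between x y z) (all₃ between a b c)
          | ∧-assoc h (evenly x y z) (all₃ evenly a b c) =
    interchange (not (t ∧ not x ∧ y)) (not (u ∧ not y ∧ z))
    where
    interchange : ∀ p q {r s k} → (p ∧ r) ∧ (q ∧ s) ∧ k ≡ (p ∧ q) ∧ r ∧ s ∧ k
    interchange false q         = refl
    interchange true  false {r} = ∧-zeroʳ r
    interchange true  true      = refl

  move : State → Bool → Bool → Bool → List State
  move s x y z = choose (legal s x y z) (step s x y z)

  successors : State → List State
  successors s = concatMap (λ x → concatMap (λ y → concatMap (move s x y) bools) bools) bools

  open Walks grow leaf bits-all? successors (λ s → 𝟙 (accepts s [] [] [])) public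

  total : ℕ → State → ℤ
  total n s = ∑ (descending n) λ a → ∑ (descending n) λ b → ∑ (descending n) λ c → 𝟙 (accepts s a b c)

  total≡walks : ∀ n s → total n s ≡ walks n s
  total≡walks zero    s = trans (ℤ.+-identityʳ _) (trans (ℤ.+-identityʳ _) (ℤ.+-identityʳ _))
  total≡walks (suc n) s = begin
    total (suc n) s
      ≡⟨ ∑-bits n _ ⟩
    ∑ bools (λ x → ∑ D λ a → ∑ D′ λ b → ∑ D′ λ c → 𝟙 (accepts s (x ∷ a) b c))
      ≡⟨ ∑-cong bools (λ {x} _ → begin
        ∑ D (λ a → ∑ D′ λ b → ∑ D′ λ c → 𝟙 (accepts s (x ∷ a) b c))
          ≡⟨ ∑-cong D (λ _ → ∑-bits n _) ⟩
        ∑ D (λ a → ∑ bools λ y → ∑ D λ b → ∑ D′ λ c → 𝟙 (accepts s (x ∷ a) (y ∷ b) c))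
          ≡⟨ ∑-swap D bools (λ a y → ∑ D λ b → ∑ D′ λ c → 𝟙 (accepts s (x ∷ a) (y ∷ b) c)) ⟩
        ∑ bools (λ y → ∑ D λ a → ∑ D λ b → ∑ D′ λ c → 𝟙 (accepts s (x ∷ a) (y ∷ b) c))
          ≡⟨ ∑-cong bools (λ {y} _ → begin
            ∑ D (λ a → ∑ D λ b → ∑ D′ λ c → 𝟙 (accepts s (x ∷ a) (y ∷ b) c))
              ≡⟨ ∑-cong D (λ {a} _ → trans (∑-cong D λ _ → ∑-bits n _)
                   (∑-swap D bools (λ b z → ∑ D λ c → 𝟙 (accepts s (x ∷ a) (y ∷ b) (z ∷ c))))) ⟩
            ∑ D (λ a → ∑ bools λ z → ∑ D λ b → ∑ D λ c → 𝟙 (accepts s (x ∷ a) (y ∷ b) (z ∷ c)))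
              ≡⟨ ∑-swap D bools (λ a z → ∑ D λ b → ∑ D λ c → 𝟙 (accepts s (x ∷ a) (y ∷ b) (z ∷ c))) ⟩
            ∑ bools (λ z → ∑ D λ a → ∑ D λ b → ∑ D λ c → 𝟙 (accepts s (x ∷ a) (y ∷ b) (z ∷ c)))
              ≡⟨ ∑-cong bools (λ {z} _ → letter x y z) ⟩
            ∑ bools (λ z → ∑ (move s x y z) (walks n))
              ≡⟨ ∑-concatMap (move s x y) bools (walks n) ⟨
            ∑ (concatMap (move s x y) bools) (walks n) ∎) ⟩
        ∑ bools (λ y → ∑ (concatMap (move s x y) bools) (walks n))
          ≡⟨ ∑-concatMap (λ y → concatMap (move s x y) bools) bools (walks n) ⟨
        ∑ (concatMap (λ y → concatMap (move s x y) bools) bools) (walks n) ∎) ⟩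
    ∑ bools (λ x → ∑ (concatMap (λ y → concatMap (move s x y) bools) bools) (walks n))
      ≡⟨ ∑-concatMap (λ x → concatMap (λ y → concatMap (move s x y) bools) bools) bools (walks n) ⟨
    walks (suc n) s ∎
    where
    open ≡-Reasoning
    D = descending n
    D′ = descending (suc n)
    letter : ∀ x y z → ∑ D (λ a → ∑ D λ b → ∑ D λ c → 𝟙 (accepts s (x ∷ a) (y ∷ b) (z ∷ c))) ≡ ∑ (move s x y z) (walks n)
    letter x y z = begin
      ∑ D (λ a → ∑ D λ b → ∑ D λ c → 𝟙 (accepts s (x ∷ a) (y ∷ b) (z ∷ c)))
        ≡⟨ ∑-cong D (λ {a} _ → ∑-cong D λ {b} _ → trans (∑-cong D λ {c} _ → cong 𝟙 (accepts-∷ s x y z a b c))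
             (∑-choose (legal s x y z) (step s x y z) D (λ t → accepts t a b))) ⟩
      ∑ D (λ a → ∑ D λ b → ∑ (move s x y z) λ t → ∑ D λ c → 𝟙 (accepts t a b c))
        ≡⟨ ∑-cong D (λ {a} _ → ∑-swap D (move s x y z) (λ b t → ∑ D λ c → 𝟙 (accepts t a b c))) ⟩
      ∑ D (λ a → ∑ (move s x y z) λ t → ∑ D λ b → ∑ D λ c → 𝟙 (accepts t a b c))
        ≡⟨ ∑-swap D (move s x y z) (λ a t → ∑ D λ b → ∑ D λ c → 𝟙 (accepts t a b c)) ⟩
      ∑ (move s x y z) (total n)
        ≡⟨ ∑-cong (move s x y z) (λ {t} _ → total≡walks n t) ⟩
      ∑ (move s x y z) (walks n) ∎

  decomposition : Decomposition components
  decomposition = toWitness {a? = decomposition? components} _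

  start : State
  start = Vec.replicate 7 true

  -- 5040/24 = 210 times the integer coefficients in the bracket of the closed form.
  weights : List (ℕ × ℤ)
  weights = (1 , -[1+ 209 ]) ∷ (2 , -[1+ 1469 ]) ∷ (3 , + 3780) ∷ (4 , -[1+ 2939 ]) ∷ (5 , + 3150) ∷ (6 , -[1+ 3149 ]) ∷ (7 , 0ℤ) ∷ (8 , + 840) ∷ []

  formula : ∀ n → + 5040 ℤ.* walks n start ≡ evaluate n weights
  formula = walks-formula decomposition refl

-- State i stands for the Stirling number S(n+1, i+1).
module Stirling where
  lower : ∀ {m} → Fin m → List (Fin m)
  lower zero    = []
  lower (suc i) = inject₁ i ∷ []

  -- The loops and the single step down are the two summands of the Stirling recurrence.
  successors : Fin 8 → List (Fin 8)
  successors i = List.replicate (suc (toℕ i)) i ++ lower i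

  initial : Fin 8 → ℤ
  initial zero    = 1ℤ
  initial (suc _) = 0ℤ

  open Walks {Table = Vec ℤ 8} Vec.tabulate Vec.lookup Fin.all? successors initial public

  walks≡stirling2 : ∀ n i → walks n i ≡ + stirling2 (suc n) (suc (toℕ i))
  walks≡stirling2 zero    zero    = refl
  walks≡stirling2 zero    (suc i) rewrite ℕ.*-zeroʳ (toℕ i) = refl
  walks≡stirling2 (suc n) i = begin
    ∑ (List.replicate (suc (toℕ i)) i ++ lower i) (walks n)
      ≡⟨ ∑-++ (List.replicate (suc (toℕ i)) i) (walks n) ⟩
    ∑ (List.replicate (suc (toℕ i)) i) (walks n) ℤ.+ ∑ (lower i) (walks n)
      ≡⟨ cong₂ ℤ._+_ (trans (∑-replicate (suc (toℕ i)) i (walks n)) (cong (+ suc (toℕ i) ℤ.*_) (walks≡stirling2 n i))) (below i) ⟩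
    + suc (toℕ i) ℤ.* + stirling2 (suc n) (suc (toℕ i)) ℤ.+ + stirling2 (suc n) (toℕ i)
      ≡⟨ cong (λ k → k ℤ.+ + stirling2 (suc n) (toℕ i)) (ℤ.pos-* (suc (toℕ i)) _) ⟨
    + (suc (toℕ i) ℕ.* stirling2 (suc n) (suc (toℕ i))) ℤ.+ + stirling2 (suc n) (toℕ i)
      ≡⟨ ℤ.pos-+ (suc (toℕ i) ℕ.* stirling2 (suc n) (suc (toℕ i))) _ ⟨
    + stirling2 (suc (suc n)) (suc (toℕ i)) ∎
    where
    open ≡-Reasoning
    below : ∀ i → ∑ (lower i) (walks n) ≡ + stirling2 (suc n) (toℕ i)
    below zero    = refl
    below (suc i) = trans (ℤ.+-identityʳ _) (trans (walks≡stirling2 n (inject₁ i))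
      (cong (λ k → + stirling2 (suc n) (suc k)) (Fin.toℕ-inject₁ i)))

  decomposition : Decomposition components
  decomposition = toWitness {a? = decomposition? components} _

  -- These lists are 5040 times the explicit formula: S(n+1,k) is 1/(k-1)! times the sum over j of
  -- (-1)^(k-j) C(k-1,j-1) jⁿ.
  weights-3 : List (ℕ × ℤ)
  weights-3 = (1 , + 2520) ∷ (2 , -[1+ 5039 ]) ∷ (3 , + 2520) ∷ (4 , 0ℤ) ∷ (5 , 0ℤ) ∷ (6 , 0ℤ) ∷ (7 , 0ℤ) ∷ (8 , 0ℤ) ∷ []
  weights-4 : List (ℕ × ℤ)
  weights-4 = (1 , -[1+ 839 ]) ∷ (2 , + 2520) ∷ (3 , -[1+ 2519 ]) ∷ (4 , + 840) ∷ (5 , 0ℤ) ∷ (6 , 0ℤ) ∷ (7 , 0ℤ) ∷ (8 , 0ℤ) ∷ []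
  weights-5 : List (ℕ × ℤ)
  weights-5 = (1 , + 210) ∷ (2 , -[1+ 839 ]) ∷ (3 , + 1260) ∷ (4 , -[1+ 839 ]) ∷ (5 , + 210) ∷ (6 , 0ℤ) ∷ (7 , 0ℤ) ∷ (8 , 0ℤ) ∷ []
  weights-6 : List (ℕ × ℤ)
  weights-6 = (1 , -[1+ 41 ]) ∷ (2 , + 210) ∷ (3 , -[1+ 419 ]) ∷ (4 , + 420) ∷ (5 , -[1+ 209 ]) ∷ (6 , + 42) ∷ (7 , 0ℤ) ∷ (8 , 0ℤ) ∷ []
  weights-7 : List (ℕ × ℤ)
  weights-7 = (1 , + 7) ∷ (2 , -[1+ 41 ]) ∷ (3 , + 105) ∷ (4 , -[1+ 139 ]) ∷ (5 , + 105) ∷ (6 , -[1+ 41 ]) ∷ (7 , + 7) ∷ (8 , 0ℤ) ∷ []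
  weights-8 : List (ℕ × ℤ)
  weights-8 = (1 , -[1+ 0 ]) ∷ (2 , + 7) ∷ (3 , -[1+ 20 ]) ∷ (4 , + 35) ∷ (5 , -[1+ 34 ]) ∷ (6 , + 21) ∷ (7 , -[1+ 6 ]) ∷ (8 , + 1) ∷ []

  formula : ∀ i {cs} → coefficients i ≡ cs → ∀ n → + 5040 ℤ.* + stirling2 (suc n) (suc (toℕ i)) ≡ evaluate n cs
  formula i e n = trans (cong (+ 5040 ℤ.*_) (sym (walks≡stirling2 n i))) (walks-formula decomposition e n)

  formula-3 : ∀ n → + 5040 ℤ.* + stirling2 (suc n) 3 ≡ evaluate n weights-3
  formula-3 = formula (Fin.# 2) refl
  formula-4 : ∀ n → + 5040 ℤ.* + stirling2 (suc n) 4 ≡ evaluate n weights-4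
  formula-4 = formula (Fin.# 3) refl
  formula-5 : ∀ n → + 5040 ℤ.* + stirling2 (suc n) 5 ≡ evaluate n weights-5
  formula-5 = formula (Fin.# 4) refl
  formula-6 : ∀ n → + 5040 ℤ.* + stirling2 (suc n) 6 ≡ evaluate n weights-6
  formula-6 = formula (Fin.# 5) refl
  formula-7 : ∀ n → + 5040 ℤ.* + stirling2 (suc n) 7 ≡ evaluate n weights-7
  formula-7 = formula (Fin.# 6) refl
  formula-8 : ∀ n → + 5040 ℤ.* + stirling2 (suc n) 8 ≡ evaluate n weights-8
  formula-8 = formula (Fin.# 7) refl

-- The second and third Betti numbers

∑-filter : ∀ {A : Set} {P : A → Set} (P? : ∀ x → Dec (P x)) L {f : A → ℤ} →
  (∀ x → ¬ P x → f x ≡ 0ℤ) → ∑ (filter P? L) f ≡ ∑ L f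
∑-filter P? []          h = refl
∑-filter P? (x ∷ L) {f} h with P? x
... | yes _ = cong (λ z → f x ℤ.+ z) (∑-filter P? L h)
... | no ¬p = trans (∑-filter P? L h) (sym (trans (cong (λ z → z ℤ.+ ∑ L f) (h x ¬p)) (ℤ.+-identityˡ _)))

∑-size-cong : ∀ {A : Set} k (L : List A) {F G : List A → ℤ} →
  (∀ S → S ⊆ L → length S ≡ k → F S ≡ G S) → ∑-size k L F ≡ ∑-size k L G
∑-size-cong k L {F} {G} h = ∑-cong (subcollections L) λ {S} S∈ →
  step (length S ℕ.≟ k) (h S (∈-subcollections⁻ L S∈))
  where
  step : ∀ {P : Set} {x y} (d : Dec P) → (P → x ≡ y) → [ d ] ℤ.* x ≡ [ d ] ℤ.* y
  step (yes p) e = cong (1ℤ ℤ.*_) (e p)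
  step (no _)  e = refl

module _ {A : Set} {_≻_ : A → A → Set} (_≻?_ : ∀ x y → Dec (x ≻ y)) (≻-asym : ∀ {x y} → x ≻ y → ¬ y ≻ x) where

  ∑-above : ∀ {x L} → All (x ≻_) L → (f : A → ℤ) → ∑ (x ∷ L) (λ y → [ x ≻? y ] ℤ.* f y) ≡ ∑ L f
  ∑-above {x} {L} x≻L f = begin
    [ x ≻? x ] ℤ.* f x ℤ.+ ∑ L (λ y → [ x ≻? y ] ℤ.* f y)
      ≡⟨ cong₂ (λ u v → u ℤ.* f x ℤ.+ v) ([]-no (x ≻? x) (λ x≻x → ≻-asym x≻x x≻x))
           (∑-cong L λ {y} y∈ → cong (ℤ._* f y) ([]-yes (x ≻? y) (All.lookup x≻L y∈))) ⟩
    0ℤ ℤ.* f x ℤ.+ ∑ L (λ y → 1ℤ ℤ.* f y)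
      ≡⟨ trans (ℤ.+-identityˡ _) (∑-cong L λ {y} _ → ℤ.*-identityˡ (f y)) ⟩
    ∑ L f ∎
    where open ≡-Reasoning

  ∑-below : ∀ {x y} L → x ≻ y → (f : A → ℤ) → ∑ (x ∷ L) (λ z → [ y ≻? z ] ℤ.* f z) ≡ ∑ L (λ z → [ y ≻? z ] ℤ.* f z)
  ∑-below {x} {y} L x≻y f = trans (cong (λ u → u ℤ.* f x ℤ.+ ∑ L (λ z → [ y ≻? z ] ℤ.* f z)) ([]-no (y ≻? x) (≻-asym x≻y))) (ℤ.+-identityˡ _)

  -- Positions in the list are traded for the relation `≻`, because the automaton reads independent
  -- words and tests their order as one more condition.
  ∑₂-sorted : ∀ {L} → AllPairs _≻_ L → (f : A → A → ℤ) →
    ∑₂ L f ≡ ∑ L (λ a → ∑ L λ b → [ a ≻? b ] ℤ.* f a b)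
  ∑₂-sorted []                  f = refl
  ∑₂-sorted {x ∷ L} (x≻L ∷ s)   f = cong₂ ℤ._+_ (sym (∑-above x≻L (f x)))
    (trans (∑₂-sorted s f) (∑-cong L λ {a} a∈ → sym (∑-below L (All.lookup x≻L a∈) (f a))))

  ∑₃-sorted : ∀ {L} → AllPairs _≻_ L → (f : A → A → A → ℤ) →
    ∑₃ L f ≡ ∑ L (λ a → ∑ L λ b → [ a ≻? b ] ℤ.* ∑ L λ c → [ b ≻? c ] ℤ.* f a b c)
  ∑₃-sorted []                f = refl
  ∑₃-sorted {x ∷ L} (x≻L ∷ s) f = cong₂ ℤ._+_
    (trans (∑₂-sorted s (f x)) (trans (∑-cong L (λ {b} → restrict x b)) (sym (∑-above x≻L _))))
    (trans (∑₃-sorted s f) (∑-cong L λ {a} a∈ → trans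
      (∑-cong L λ {b} b∈ → cong ([ a ≻? b ] ℤ.*_) (restrict a b b∈)) (sym (∑-below L (All.lookup x≻L a∈) (λ b → ∑ (x ∷ L) λ c → [ b ≻? c ] ℤ.* f a b c)))))
    where
    restrict : ∀ a b → b ∈ L → ∑ L (λ c → [ b ≻? c ] ℤ.* f a b c) ≡ ∑ (x ∷ L) (λ c → [ b ≻? c ] ℤ.* f a b c)
    restrict a b b∈ = sym (∑-below L (All.lookup x≻L b∈) (f a b))

𝟙-∧ : ∀ x y → 𝟙 x ℤ.* 𝟙 y ≡ 𝟙 (x ∧ y)
𝟙-∧ true  y = ℤ.*-identityˡ (𝟙 y)
𝟙-∧ false y = refl

𝟙-≟ : ∀ x → [ x 𝔹.≟ true ] ≡ 𝟙 x
𝟙-≟ true  = refl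
𝟙-≟ false = refl

-- Lets the sums run over all words of length `n`: the empty set meets nothing, so the summands
-- below vanish on it.
∑-ground : ∀ n {f : Subset n → ℤ} → (∀ a → ¬ Nonempty a → f a ≡ 0ℤ) → ∑ (ground n) f ≡ ∑ (descending n) f
∑-ground n h = ∑-filter _ (descending n) λ a e → h a (e ∘ isNonempty⁺ a)

disjoint⇒0 : ∀ {n} (a b : Subset n) → ¬ Meet a b → 𝟙 (not (disjoint a b)) ≡ 0ℤ
disjoint⇒0 a b ¬m with disjoint a b in e
... | true  = refl
... | false = contradiction (disjoint-false a b e) ¬m

avoids-meets : ∀ {n} (a b c : Subset n) → avoids a b c ≡ true → Meet a b × Meet a c
avoids-meets a b c h =
  let ab , h₁ = ∧-true {not (disjoint a b)} h
      ac , _  = ∧-true {not (disjoint a c)} h₁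
  in disjoint-false a b (not-true ab) , disjoint-false a c (not-true ac)

-- The two intersections with `a` already witness that all three sets are nonempty, as `∑-ground`
-- requires.
avoids⇒0 : ∀ {n} (a b c : Subset n) → ¬ (Meet a b × Meet a c) → 𝟙 (avoids a b c) ≡ 0ℤ
avoids⇒0 a b c ¬m = cong 𝟙 (≢true (¬m ∘ avoids-meets a b c))

*-0ʳ : ∀ k {x} → x ≡ 0ℤ → k ℤ.* x ≡ 0ℤ
*-0ʳ k refl = ℤ.*-zeroʳ k

∑-0ʳ : ∀ {A : Set} (L : List A) {f : A → ℤ} → (∀ x → f x ≡ 0ℤ) → ∑ L f ≡ 0ℤ
∑-0ʳ L h = trans (∑-cong L λ {x} _ → h x) (∑-0 L)

pairs-count : ∀ n → ∑₂ (ground n) (λ a b → 𝟙 (not (disjoint a b))) ≡ Pairs.walks n Pairs.start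
pairs-count n = begin
  ∑₂ (ground n) (λ a b → 𝟙 (not (disjoint a b)))
    ≡⟨ ∑₂-sorted _≻?_ ≻-asym (ground-sorted n) _ ⟩
  ∑ (ground n) (λ a → ∑ (ground n) λ b → [ a ≻? b ] ℤ.* 𝟙 (not (disjoint a b)))
    ≡⟨ ∑-ground n (λ a ¬a → ∑-0ʳ (ground n) λ b → *-0ʳ [ a ≻? b ] (disjoint⇒0 a b λ (i , ai , _) → ¬a (i , ai))) ⟩
  ∑ (descending n) (λ a → ∑ (ground n) λ b → [ a ≻? b ] ℤ.* 𝟙 (not (disjoint a b)))
    ≡⟨ ∑-cong (descending n) (λ {a} _ → trans
         (∑-ground n λ b ¬b → *-0ʳ [ a ≻? b ] (disjoint⇒0 a b λ (i , _ , bi) → ¬b (i , bi)))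
         (∑-cong (descending n) λ {b} _ → trans (𝟙-∧ (does (a ≻? b)) _)
           (cong (λ t → 𝟙 (t ∧ not (disjoint a b))) (sym (ordered-true a b))))) ⟩
  Pairs.total n Pairs.start
    ≡⟨ Pairs.total≡walks n Pairs.start ⟩
  Pairs.walks n Pairs.start ∎
  where open ≡-Reasoning

triples-count : ∀ n → ∑₃ (ground n) (λ a b c → 𝟙 (avoids a b c)) ≡ Triples.walks n Triples.start
triples-count n = begin
  ∑₃ (ground n) (λ a b c → 𝟙 (avoids a b c))
    ≡⟨ ∑₃-sorted _≻?_ ≻-asym (ground-sorted n) _ ⟩
  ∑ (ground n) (λ a → ∑ (ground n) λ b → [ a ≻? b ] ℤ.* inner (ground n) a b)
    ≡⟨ ∑-ground n (λ a ¬a → ∑-0ʳ (ground n) λ b → *-0ʳ [ a ≻? b ] (∑-0ʳ (ground n) λ c → *-0ʳ [ b ≻? c ]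
         (avoids⇒0 a b c λ ((i , ai , _) , _) → ¬a (i , ai)))) ⟩
  ∑ (descending n) (λ a → ∑ (ground n) λ b → [ a ≻? b ] ℤ.* inner (ground n) a b)
    ≡⟨ ∑-cong (descending n) (λ {a} _ → trans
         (∑-ground n λ b ¬b → *-0ʳ [ a ≻? b ] (∑-0ʳ (ground n) λ c → *-0ʳ [ b ≻? c ]
           (avoids⇒0 a b c λ ((i , _ , bi) , _) → ¬b (i , bi))))
         (∑-cong (descending n) λ {b} _ → trans
           (cong ([ a ≻? b ] ℤ.*_) (∑-ground n λ c ¬c → *-0ʳ [ b ≻? c ]
             (avoids⇒0 a b c λ (_ , (i , _ , ci)) → ¬c (i , ci))))
           (trans (sym (∑-*ˡ [ a ≻? b ] (descending n) _)) (∑-cong (descending n) λ {c} _ → word a b c)))) ⟩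
  Triples.total n Triples.start
    ≡⟨ Triples.total≡walks n Triples.start ⟩
  Triples.walks n Triples.start ∎
  where
  open ≡-Reasoning
  inner : List (Subset n) → Subset n → Subset n → ℤ
  inner L a b = ∑ L λ c → [ b ≻? c ] ℤ.* 𝟙 (avoids a b c)
  word : ∀ a b c → [ a ≻? b ] ℤ.* ([ b ≻? c ] ℤ.* 𝟙 (avoids a b c)) ≡ 𝟙 (Triples.accepts Triples.start a b c)
  word a b c = begin
    [ a ≻? b ] ℤ.* ([ b ≻? c ] ℤ.* 𝟙 (avoids a b c))
      ≡⟨ cong ([ a ≻? b ] ℤ.*_) (𝟙-∧ (does (b ≻? c)) (avoids a b c)) ⟩
    [ a ≻? b ] ℤ.* 𝟙 (does (b ≻? c) ∧ avoids a b c)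
      ≡⟨ 𝟙-∧ (does (a ≻? b)) _ ⟩
    𝟙 (does (a ≻? b) ∧ does (b ≻? c) ∧ avoids a b c)
      ≡⟨ cong₂ (λ t u → 𝟙 (t ∧ u ∧ avoids a b c)) (ordered-true a b) (ordered-true b c) ⟨
    𝟙 (Triples.accepts Triples.start a b c) ∎

-- The rank of the whole arrangement and the coefficients of its characteristic polynomial

singletons : ∀ n → List (Subset n)
singletons zero    = []
singletons (suc n) = (true ∷ replicate n false) ∷ map (false ∷_) (singletons n)

length-singletons : ∀ n → length (singletons n) ≡ n
length-singletons zero    = refl
length-singletons (suc n) = cong suc (trans (length-map (false ∷_) (singletons n)) (length-singletons n))

linComb-pad : ∀ {n} c (S : List (Subset n)) i →
  linComb c (map normal (map (false ∷_) S)) (suc i) ≡ linComb c (map normal S) i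
linComb-pad []      S       i = refl
linComb-pad (x ∷ c) []      i = refl
linComb-pad (x ∷ c) (s ∷ S) i = cong (λ z → x ℚ.* normal s i ℚ.+ z) (linComb-pad c S i)

padded-avoid : ∀ {n} (S : List (Subset n)) → All (λ s → lookup s zero ≡ false) (map (false ∷_) S)
padded-avoid S = All.map⁺ (All.universal (λ _ → refl) S)

singletons-span : ∀ {n} (x : Subset n) → Span (map normal (singletons n)) (normal x)
singletons-span []      = [] , λ ()
singletons-span {suc n} (b ∷ x) with singletons-span x
... | c , p = ⟦ b ⟧ ∷ c , λ
  { zero    → sym (trans (cong (λ z → ⟦ b ⟧ ℚ.* 1ℚ ℚ.+ z) (linComb-avoids c _ (padded-avoid (singletons n))))
                (trans (ℚ.+-identityʳ _) (ℚ.*-identityʳ ⟦ b ⟧)))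
  ; (suc i) → sym (trans (cong₂ (λ u z → ⟦ b ⟧ ℚ.* ⟦ u ⟧ ℚ.+ z) (lookup-replicate i false) (linComb-pad c (singletons n) i))
                (trans (cong (λ z → z ℚ.+ linComb c (map normal (singletons n)) i) (ℚ.*-zeroʳ ⟦ b ⟧))
                (trans (ℚ.+-identityˡ _) (sym (p i))))) }

singletons-nonempty : ∀ {n} {s : Subset n} → s ∈ singletons n → isNonempty s ≡ true
singletons-nonempty {suc n} (here refl) = refl
singletons-nonempty {suc n} (there s∈) with ∈-map⁻ (false ∷_) s∈
... | t , t∈ , refl = singletons-nonempty t∈

module Betti {n} (r : List (Subset n) → ℕ) (isRank : IsRankFunction r) where

  -- The dimension stays a parameter because `singletons-ind` is an induction on it, while `r` lives
  -- in dimension `n`.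
  open module M {m} = Matroid (Cl {m}) cl-stable cl-∈ cl-trans cl-exchange

  linIndep⇒ind : ∀ {m} (T : List (Subset m)) → LinIndep (map normal T) → Ind T
  linIndep⇒ind []      _ = tt
  linIndep⇒ind (x ∷ T) h = (λ c → ¬¬-span c (linIndep-head h)) , linIndep⇒ind T (linIndep-tail h)

  ind⇒linIndep : ∀ {m} (T : List (Subset m)) → Ind T → LinIndep (map normal T)
  ind⇒linIndep []      _        = linIndep-[]
  ind⇒linIndep (x ∷ T) (x∉ , i) = linIndep-∷ (λ s → x∉ (closure λ k → k s)) (ind⇒linIndep T i)

  singletons-ind : ∀ m → Ind (singletons m)
  singletons-ind zero    = tt
  singletons-ind (suc m) = cl-avoids zero refl (padded-avoid (singletons m)) , pad (singletons m) (singletons-ind m)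
    where
    pad : ∀ S → Ind S → Ind (map (false ∷_) S)
    pad []      _        = tt
    pad (x ∷ S) (x∉ , i) =
      (λ cx → ¬¬-span cx λ (c , p) → x∉ (closure λ k → k (c , λ j → trans (p (suc j)) (linComb-pad c S j)))) , pad S i

  r-attained : ∀ S → ∃ λ T → T ⊆ S × length T ≡ r S × Ind T
  r-attained S with proj₁ (isRank S)
  ... | T , T⊆S , len , ind = T , T⊆S , len , linIndep⇒ind T ind

  r-maximal : ∀ S T → T ⊆ S → Ind T → length T ≤ r S
  r-maximal S T T⊆S ind = proj₂ (isRank S) T T⊆S (ind⇒linIndep T ind)

  open Rank r r-attained r-maximal

  -- The unit vectors belong to the arrangement, are independent and span everything. With rank `n`,
  -- the exponent n - i singles out the subcollections of rank `i`.
  rank-resonance : r (resonance n) ≡ n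
  rank-resonance = trans
    (rank-cong (λ {s} _ → closure λ k → k (singletons-span s))
               (λ {s} s∈ → cl-∈ (↭.∈-resp-↭ (↭-sym (resonance-↭ n)) (∈-ground⁺ (isNonempty⁻ s (singletons-nonempty s∈))))))
    (trans (rank-ind (singletons-ind n)) (length-singletons n))

  open Whitney (Cl {n}) cl-stable cl-∈ cl-trans cl-exchange cl? using (nbc?; signed-↭; signed-rank)
  open Circuits {n} cl?

  nbc-count : ℕ → ℤ
  nbc-count i = ∑-size i (ground n) λ S → [ nbc? _≻_ _≻?_ ≻-asym (ground n) S ]

  coefficient : ∀ i → charPolyCoeff r (resonance n) (+ n ℤ.- + i) ≡ signPow i ℤ.* nbc-count i
  coefficient i = begin
    charPolyCoeff r (resonance n) (+ n ℤ.- + i)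
      ≡⟨ ∑-cong (subcollections (resonance n)) (λ {S} _ →
           shape (+ r (resonance n) ℤ.- + r S ℤ.≟ + n ℤ.- + i) (r S ℕ.≟ i) (to S) (from S)) ⟩
    signed (resonance n) (λ S → [ r S ℕ.≟ i ])
      ≡⟨ signed-↭ (resonance-↭ n) (λ h h′ → cong (λ k → [ k ℕ.≟ i ]) (rank-cong h h′)) ⟩
    signed (ground n) (λ S → [ r S ℕ.≟ i ])
      ≡⟨ signed-rank _≻_ _≻?_ ≻-asym r rank-cong rank-ind (ground-sorted n) i ⟩
    signPow i ℤ.* nbc-count i ∎
    where
    open ≡-Reasoning
    shape : ∀ {P Q : Set} {s} (d : Dec P) (e : Dec Q) → (P → Q) → (Q → P) → (if does d then s else 0ℤ) ≡ s ℤ.* [ e ]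
    shape {s = s} (yes p) e f g = sym (trans (cong (s ℤ.*_) ([]-yes e (f p))) (ℤ.*-identityʳ s))
    shape {s = s} (no ¬p) e f g = sym (trans (cong (s ℤ.*_) ([]-no e (¬p ∘ g))) (ℤ.*-zeroʳ s))
    undo : ∀ x y → x ℤ.- (x ℤ.- y) ≡ y
    undo = solve-∀
    to : ∀ S → + r (resonance n) ℤ.- + r S ≡ + n ℤ.- + i → r S ≡ i
    to S e = ℤ.+-injective (trans (sym (undo (+ n) (+ r S)))
      (trans (cong (λ z → + n ℤ.- z) (trans (cong (λ m → + m ℤ.- + r S) (sym rank-resonance)) e)) (undo (+ n) (+ i))))
    from : ∀ S → r S ≡ i → + r (resonance n) ℤ.- + r S ≡ + n ℤ.- + i
    from S e = cong₂ (λ x y → + x ℤ.- + y) rank-resonance e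

  betti-nbc : ∀ {m} i → nbc-count i ≡ + m → betti r (resonance n) i ≡ m
  betti-nbc {m} i e = trans (cong ∣_∣ (trans (coefficient i) (cong (signPow i ℤ.*_) e)))
    (trans (ℤ.abs-* (signPow i) (+ m)) (trans (cong (ℕ._* m) (unit i)) (ℕ.*-identityˡ m)))
    where
    unit : ∀ i → ∣ signPow i ∣ ≡ 1
    unit zero    = refl
    unit (suc i) = trans (ℤ.abs-* -1ℤ (signPow i)) (trans (ℕ.+-identityʳ _) (unit i))

  nbc-count-2 : nbc-count 2 ≡ Pairs.walks n Pairs.start
  nbc-count-2 = begin
    nbc-count 2 ≡⟨ ∑-size-cong 2 (ground n) {G = F} explicit ⟩
    ∑-size 2 (ground n) F ≡⟨ ∑-size-2 (ground n) F ⟩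
    ∑₂ (ground n) (λ a b → 𝟙 (not (disjoint a b))) ≡⟨ pairs-count n ⟩
    Pairs.walks n Pairs.start ∎
    where
    open ≡-Reasoning
    F : List (Subset n) → ℤ
    F (a ∷ b ∷ []) = 𝟙 (not (disjoint a b))
    F _            = 0ℤ
    explicit : ∀ S → S ⊆ ground n → length S ≡ 2 → [ nbc? _≻_ _≻?_ ≻-asym (ground n) S ] ≡ F S
    explicit (a ∷ b ∷ []) S⊆ refl with allPairs-⊆ S⊆ (ground-sorted n)
    ... | (a≻b ∷ []) ∷ _ = trans ([]-cong (nbc? _≻_ _≻?_ ≻-asym (ground n) (a ∷ b ∷ [])) (not (disjoint a b) 𝔹.≟ true)
      (λ h → cong not (nbc-pair⁻ (∈-ground⁻ (Sublist.lookup S⊆ (there (here refl)))) h))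
      (λ h → nbc-pair⁺ a≻b (disjoint-false a b (not-true h))))
      (𝟙-≟ (not (disjoint a b)))

  nbc-count-3 : nbc-count 3 ≡ Triples.walks n Triples.start
  nbc-count-3 = begin
    nbc-count 3 ≡⟨ ∑-size-cong 3 (ground n) {G = F} explicit ⟩
    ∑-size 3 (ground n) F ≡⟨ ∑-size-3 (ground n) F ⟩
    ∑₃ (ground n) (λ a b c → 𝟙 (avoids a b c)) ≡⟨ triples-count n ⟩
    Triples.walks n Triples.start ∎
    where
    open ≡-Reasoning
    F : List (Subset n) → ℤ
    F (a ∷ b ∷ c ∷ []) = 𝟙 (avoids a b c)
    F _                = 0ℤ
    explicit : ∀ S → S ⊆ ground n → length S ≡ 3 → [ nbc? _≻_ _≻?_ ≻-asym (ground n) S ] ≡ F S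
    explicit (a ∷ b ∷ c ∷ []) S⊆ refl with allPairs-⊆ S⊆ (ground-sorted n)
    ... | (a≻b ∷ _) ∷ (b≻c ∷ []) ∷ _ = trans ([]-cong (nbc? _≻_ _≻?_ ≻-asym (ground n) (a ∷ b ∷ c ∷ [])) (avoids a b c 𝔹.≟ true)
      (nbc-triple⁻ (∈-ground⁻ (Sublist.lookup S⊆ (there (here refl)))) (∈-ground⁻ (Sublist.lookup S⊆ (there (there (here refl))))) b≻c)
      (nbc-triple⁺ a≻b b≻c))
      (𝟙-≟ (avoids a b c))

-- Comparison with Stirling numbers and powers

module ClosedForms (n : ℕ) where
  open ℤSolver.+-*-Solver using (solve; con; _:+_; _:*_; _:=_; Polynomial)
  open ≡-Reasoning

  p : ℕ → ℤ
  p k = + (k ^ n)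

  S : ℕ → ℕ
  S = stirling2 (suc n)

  -- `evaluate` as a solver term with the powers 1ⁿ, ..., 8ⁿ as indeterminates; the identities
  -- needed are linear in them and hold coefficient by coefficient.
  formal : ∀ {m} → List (ℕ × ℤ) → List (Polynomial m) → Polynomial m
  formal []             _        = con 0ℤ
  formal (_ ∷ _)        []       = con 0ℤ
  formal ((_ , c) ∷ cs) (x ∷ xs) = con c :* x :+ formal cs xs

  σ₂ σ₃ : ℕ
  σ₂ = 2 * S 3 + 3 * S 4
  σ₃ = 9 * S 4 + 80 * S 5 + 345 * S 6 + 840 * S 7 + 840 * S 8

  σ₂-formula : + 5040 ℤ.* + σ₂ ≡ evaluate n Pairs.weights
  σ₂-formula = begin
    + 5040 ℤ.* + σ₂
      ≡⟨ cong (+ 5040 ℤ.*_) (cong₂ ℤ._+_ (ℤ.pos-* 2 (S 3)) (ℤ.pos-* 3 (S 4))) ⟩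
    + 5040 ℤ.* (+ 2 ℤ.* + S 3 ℤ.+ + 3 ℤ.* + S 4)
      ≡⟨ solve 2 (λ x y → con (+ 5040) :* (con (+ 2) :* x :+ con (+ 3) :* y) :=
           con (+ 2) :* (con (+ 5040) :* x) :+ con (+ 3) :* (con (+ 5040) :* y)) refl (+ S 3) (+ S 4) ⟩
    + 2 ℤ.* (+ 5040 ℤ.* + S 3) ℤ.+ + 3 ℤ.* (+ 5040 ℤ.* + S 4)
      ≡⟨ cong₂ (λ u v → + 2 ℤ.* u ℤ.+ + 3 ℤ.* v) (Stirling.formula-3 n) (Stirling.formula-4 n) ⟩
    + 2 ℤ.* evaluate n Stirling.weights-3 ℤ.+ + 3 ℤ.* evaluate n Stirling.weights-4
      ≡⟨ solve 8 (λ a b c d e f g h → let x = a ∷ b ∷ c ∷ d ∷ e ∷ f ∷ g ∷ h ∷ [] in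
           con (+ 2) :* formal Stirling.weights-3 x :+ con (+ 3) :* formal Stirling.weights-4 x :=
           formal Pairs.weights x) refl (p 1) (p 2) (p 3) (p 4) (p 5) (p 6) (p 7) (p 8) ⟩
    evaluate n Pairs.weights ∎

  σ₃-formula : + 5040 ℤ.* + σ₃ ≡ evaluate n Triples.weights
  σ₃-formula = begin
    + 5040 ℤ.* + σ₃
      ≡⟨ cong (+ 5040 ℤ.*_) (cong₂ ℤ._+_ (cong₂ ℤ._+_ (cong₂ ℤ._+_ (cong₂ ℤ._+_
           (ℤ.pos-* 9 (S 4)) (ℤ.pos-* 80 (S 5))) (ℤ.pos-* 345 (S 6))) (ℤ.pos-* 840 (S 7))) (ℤ.pos-* 840 (S 8))) ⟩
    + 5040 ℤ.* (+ 9 ℤ.* + S 4 ℤ.+ + 80 ℤ.* + S 5 ℤ.+ + 345 ℤ.* + S 6 ℤ.+ + 840 ℤ.* + S 7 ℤ.+ + 840 ℤ.* + S 8)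
      ≡⟨ solve 5 (λ a b c d e → con (+ 5040) :* (con (+ 9) :* a :+ con (+ 80) :* b :+ con (+ 345) :* c :+ con (+ 840) :* d :+ con (+ 840) :* e) :=
           con (+ 9) :* (con (+ 5040) :* a) :+ con (+ 80) :* (con (+ 5040) :* b) :+ con (+ 345) :* (con (+ 5040) :* c)
             :+ con (+ 840) :* (con (+ 5040) :* d) :+ con (+ 840) :* (con (+ 5040) :* e))
           refl (+ S 4) (+ S 5) (+ S 6) (+ S 7) (+ S 8) ⟩
    + 9 ℤ.* (+ 5040 ℤ.* + S 4) ℤ.+ + 80 ℤ.* (+ 5040 ℤ.* + S 5) ℤ.+ + 345 ℤ.* (+ 5040 ℤ.* + S 6)
      ℤ.+ + 840 ℤ.* (+ 5040 ℤ.* + S 7) ℤ.+ + 840 ℤ.* (+ 5040 ℤ.* + S 8)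
      ≡⟨ cong₂ ℤ._+_ (cong₂ ℤ._+_ (cong₂ ℤ._+_ (cong₂ ℤ._+_
           (cong (+ 9 ℤ.*_) (Stirling.formula-4 n)) (cong (+ 80 ℤ.*_) (Stirling.formula-5 n)))
           (cong (+ 345 ℤ.*_) (Stirling.formula-6 n))) (cong (+ 840 ℤ.*_) (Stirling.formula-7 n)))
           (cong (+ 840 ℤ.*_) (Stirling.formula-8 n)) ⟩
    + 9 ℤ.* evaluate n Stirling.weights-4 ℤ.+ + 80 ℤ.* evaluate n Stirling.weights-5
      ℤ.+ + 345 ℤ.* evaluate n Stirling.weights-6 ℤ.+ + 840 ℤ.* evaluate n Stirling.weights-7
      ℤ.+ + 840 ℤ.* evaluate n Stirling.weights-8
      ≡⟨ solve 8 (λ a b c d e f g h → let x = a ∷ b ∷ c ∷ d ∷ e ∷ f ∷ g ∷ h ∷ [] in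
           con (+ 9) :* formal Stirling.weights-4 x :+ con (+ 80) :* formal Stirling.weights-5 x
             :+ con (+ 345) :* formal Stirling.weights-6 x :+ con (+ 840) :* formal Stirling.weights-7 x
             :+ con (+ 840) :* formal Stirling.weights-8 x :=
           formal Triples.weights x) refl (p 1) (p 2) (p 3) (p 4) (p 5) (p 6) (p 7) (p 8) ⟩
    evaluate n Triples.weights ∎

  pairs≡σ₂ : Pairs.walks n Pairs.start ≡ + σ₂
  pairs≡σ₂ = ℤ.*-cancelˡ-≡ (+ 5040) _ _
    (trans (Pairs.formula n) (sym σ₂-formula))

  triples≡σ₃ : Triples.walks n Triples.start ≡ + σ₃
  triples≡σ₃ = ℤ.*-cancelˡ-≡ (+ 5040) _ _
    (trans (Triples.formula n) (sym σ₃-formula))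

  p1≡1 : p 1 ≡ 1ℤ
  p1≡1 = cong +_ (ℕ.^-zeroˡ n)

  -- The factor 2520 is chosen so that 2520 · 2 = 5040 and `σ₂-formula` applies; the constant 1 is
  -- the power 1ⁿ.
  σ₂-closed : 2 * σ₂ + 3 ^ n + 2 ^ n ≡ 4 ^ n + 1
  σ₂-closed = ℤ.+-injective (ℤ.*-cancelˡ-≡ (+ 2520) _ _ (begin
    + 2520 ℤ.* (+ (2 * σ₂) ℤ.+ p 3 ℤ.+ p 2)
      ≡⟨ cong (λ z → + 2520 ℤ.* (z ℤ.+ p 3 ℤ.+ p 2)) (ℤ.pos-* 2 σ₂) ⟩
    + 2520 ℤ.* (+ 2 ℤ.* + σ₂ ℤ.+ p 3 ℤ.+ p 2)
      ≡⟨ solve 3 (λ m x y → con (+ 2520) :* (con (+ 2) :* m :+ y :+ x) := con (+ 5040) :* m :+ con (+ 2520) :* (y :+ x))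
           refl (+ σ₂) (p 2) (p 3) ⟩
    + 5040 ℤ.* + σ₂ ℤ.+ + 2520 ℤ.* (p 3 ℤ.+ p 2)
      ≡⟨ cong (λ z → z ℤ.+ + 2520 ℤ.* (p 3 ℤ.+ p 2)) σ₂-formula ⟩
    evaluate n Pairs.weights ℤ.+ + 2520 ℤ.* (p 3 ℤ.+ p 2)
      ≡⟨ solve 8 (λ a b c d e f g h → formal Pairs.weights (a ∷ b ∷ c ∷ d ∷ e ∷ f ∷ g ∷ h ∷ []) :+ con (+ 2520) :* (c :+ b) :=
           con (+ 2520) :* (d :+ a)) refl (p 1) (p 2) (p 3) (p 4) (p 5) (p 6) (p 7) (p 8) ⟩
    + 2520 ℤ.* (p 4 ℤ.+ p 1)
      ≡⟨ cong (λ z → + 2520 ℤ.* (p 4 ℤ.+ z)) p1≡1 ⟩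
    + 2520 ℤ.* (p 4 ℤ.+ 1ℤ) ∎))

  -- Likewise 210 · 24 = 5040. The negative terms stand on the left so that the identity lives in ℕ.
  σ₃-closed : 24 * σ₃ + 15 * 6 ^ n + 14 * 4 ^ n + 7 * 2 ^ n + 1 ≡ 4 * 8 ^ n + 15 * 5 ^ n + 18 * 3 ^ n
  σ₃-closed = ℤ.+-injective (ℤ.*-cancelˡ-≡ (+ 210) _ _ (begin
    + 210 ℤ.* (+ (24 * σ₃) ℤ.+ + (15 * 6 ^ n) ℤ.+ + (14 * 4 ^ n) ℤ.+ + (7 * 2 ^ n) ℤ.+ 1ℤ)
      ≡⟨ cong (+ 210 ℤ.*_) (cong₂ ℤ._+_ (cong₂ ℤ._+_ (cong₂ ℤ._+_ (cong₂ ℤ._+_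
           (ℤ.pos-* 24 σ₃) (ℤ.pos-* 15 (6 ^ n))) (ℤ.pos-* 14 (4 ^ n))) (ℤ.pos-* 7 (2 ^ n))) (sym p1≡1)) ⟩
    + 210 ℤ.* (+ 24 ℤ.* + σ₃ ℤ.+ + 15 ℤ.* p 6 ℤ.+ + 14 ℤ.* p 4 ℤ.+ + 7 ℤ.* p 2 ℤ.+ p 1)
      ≡⟨ solve 5 (λ m a b d f → con (+ 210) :* (con (+ 24) :* m :+ con (+ 15) :* f :+ con (+ 14) :* d :+ con (+ 7) :* b :+ a) :=
           con (+ 5040) :* m :+ con (+ 210) :* (con (+ 15) :* f :+ con (+ 14) :* d :+ con (+ 7) :* b :+ a))
           refl (+ σ₃) (p 1) (p 2) (p 4) (p 6) ⟩
    + 5040 ℤ.* + σ₃ ℤ.+ rest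
      ≡⟨ cong (λ z → z ℤ.+ rest) σ₃-formula ⟩
    evaluate n Triples.weights ℤ.+ rest
      ≡⟨ solve 8 (λ a b c d e f g h → formal Triples.weights (a ∷ b ∷ c ∷ d ∷ e ∷ f ∷ g ∷ h ∷ [])
             :+ con (+ 210) :* (con (+ 15) :* f :+ con (+ 14) :* d :+ con (+ 7) :* b :+ a) :=
           con (+ 210) :* (con (+ 4) :* h :+ con (+ 15) :* e :+ con (+ 18) :* c))
           refl (p 1) (p 2) (p 3) (p 4) (p 5) (p 6) (p 7) (p 8) ⟩
    + 210 ℤ.* (+ 4 ℤ.* p 8 ℤ.+ + 15 ℤ.* p 5 ℤ.+ + 18 ℤ.* p 3)
      ≡⟨ cong (+ 210 ℤ.*_) (cong₂ ℤ._+_ (cong₂ ℤ._+_ (ℤ.pos-* 4 (8 ^ n)) (ℤ.pos-* 15 (5 ^ n))) (ℤ.pos-* 18 (3 ^ n))) ⟨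
    + 210 ℤ.* (+ (4 * 8 ^ n) ℤ.+ + (15 * 5 ^ n) ℤ.+ + (18 * 3 ^ n)) ∎))
    where
    rest : ℤ
    rest = + 210 ℤ.* (+ 15 ℤ.* p 6 ℤ.+ + 14 ℤ.* p 4 ℤ.+ + 7 ℤ.* p 2 ℤ.+ p 1)

theorem1p5 : (n : ℕ) → 1 ≤ n →
    (r : List' n → ℕ) → IsRankFunction r →
    ((betti r (resonance n) 2 ≡ 2 * stirling2 (n + 1) 3 + 3 * stirling2 (n + 1) 4)
    × (2 * betti r (resonance n) 2 + 3 ^ n + 2 ^ n ≡ 4 ^ n + 1))
    × ((betti r (resonance n) 3 ≡ 9 * stirling2 (n + 1) 4 + 80 * stirling2 (n + 1) 5
    + 345 * stirling2 (n + 1) 6 + 840 * stirling2 (n + 1) 7 + 840 * stirling2 (n + 1) 8)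
    × (24 * betti r (resonance n) 3 + 15 * 6 ^ n + 14 * 4 ^ n + 7 * 2 ^ n + 1
    ≡ 4 * 8 ^ n + 15 * 5 ^ n + 18 * 3 ^ n))
theorem1p5 n _ r isRank rewrite ℕ.+-comm n 1 =
  (b₂ , subst (λ b → 2 * b + 3 ^ n + 2 ^ n ≡ 4 ^ n + 1) (sym b₂) σ₂-closed) ,
  (b₃ , subst (λ b → 24 * b + 15 * 6 ^ n + 14 * 4 ^ n + 7 * 2 ^ n + 1 ≡ 4 * 8 ^ n + 15 * 5 ^ n + 18 * 3 ^ n) (sym b₃) σ₃-closed)
  where
  open ClosedForms n
  open Betti r isRank
  b₂ : betti r (resonance n) 2 ≡ σ₂
  b₂ = betti-nbc 2 (trans nbc-count-2 pairs≡σ₂)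
  b₃ : betti r (resonance n) 3 ≡ σ₃
  b₃ = betti-nbc 3 (trans nbc-count-3 triples≡σ₃)
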